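{- Let $\Gamma=(S,R)$ be a finite tree with a perfect matching $\mathcal P$, and let $xy\in R$ be an edge. Let $\widehat\Gamma$ be the tree obtained from $\Gamma$ by inserting a new vertex $z$ on the edge $xy$ (i.e. vertex set $S\cup\{z\}$ and edge set $(R\setminus\{xy\})\cup\{xz,yz\}$). If $xy$ is of odd type, then $\widehat\Gamma$ is $1$-lit; if $xy$ is of even type, then $\widehat\Gamma$ is $2$-lit.
   Context: Lit-only $\sigma$-game: for a finite simple graph, a configuration assigns on or off to every vertex; a move chooses an on vertex $s$ and changes the states of all neighbors of $s$. A graph is $k$-lit if for every configuration the number of on vertices can be reduced to at most $k$ by a finite sequence of moves. An alternating path in $\Gamma$ (with respect to $\mathcal P$) is a path whose edges belong alternately to $\mathcal P$ and not to $\mathcal P$. For $s\in S$, let $A_s$ be the set of vertices $t\in S\setminus\{s\}$ such that the path in $\Gamma$ joining $s$ and $t$ is an alternating path whose first edge (the one at $s$) and last edge (the one at $t$) both belong to $\mathcal P$; set $a_s=|A_s|$. An edge $st\in R$ is of odd type if $a_s+a_t$ is odd and of even type if $a_s+a_t$ is even. -}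

module Defs where

open import Data.Nat using (ℕ; zero; suc; _+_; _≤_; _%_)
open import Data.Fin using (Fin; zero; suc; _≟_)
open import Data.Bool using (Bool; true; false; not; if_then_else_; _∧_; _∨_)
open import Data.List using (List; []; _∷_; map; allFin; length; head; last)
open import Data.List.Relation.Unary.Unique.Propositional using (Unique)
open import Data.Nat.ListAction using (sum)
open import Data.Maybe using (Maybe; just)
open import Data.Product using (Σ; ∃; _×_; _,_)
open import Data.Unit using (⊤)
open import Relation.Nullary using (¬_; ⌊_⌋)
open import Relation.Binary.PropositionalEquality using (_≡_; _≢_)
open import Relation.Binary.Construct.Closure.ReflexiveTransitive using (Star)
open import Function.Definitions using (Injective)

Adj : ℕ → Set
Adj n = Fin n → Fin n → Bool

Edge : ∀ {n} → Adj n → Fin n → Fin n → Set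
Edge adj u v = adj u v ≡ true

record IsSimple {n} (adj : Adj n) : Set where
  field
    sym     : ∀ u v → adj u v ≡ adj v u
    irrefl  : ∀ u → adj u u ≡ false

data Walk {n} (adj : Adj n) : Fin n → Fin n → Set where
  here : ∀ {s} → Walk adj s s
  step : ∀ {s u t} → Edge adj s u → Walk adj u t → Walk adj s t

vertices : ∀ {n} {adj : Adj n} {s t} → Walk adj s t → List (Fin n)
vertices {s = s} here = s ∷ []
vertices {s = s} (step _ w) = s ∷ vertices w

edges : ∀ {n} {adj : Adj n} {s t} → Walk adj s t → List (Fin n × Fin n)
edges here = []
edges {s = s} (step {u = u} _ w) = (s , u) ∷ edges w

IsPath : ∀ {n} {adj : Adj n} {s t} → Walk adj s t → Set
IsPath w = Unique (vertices w)

Connected : ∀ {n} → Adj n → Set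
Connected adj = ∀ u v → Walk adj u v

HasCycle : ∀ {n} → Adj n → Set
HasCycle adj = Σ _ λ u → Σ _ λ v → Σ (Walk adj u v) λ w →
  IsPath w × 2 ≤ length (edges w) × Edge adj v u

record IsTree {n} (adj : Adj n) : Set where
  field
    simple    : IsSimple adj
    connected : Connected adj
    acyclic   : ¬ HasCycle adj

record IsPerfectMatching {n} (adj : Adj n) (P : Adj n) : Set where
  field
    sub    : ∀ u v → P u v ≡ true → adj u v ≡ true
    sym    : ∀ u v → P u v ≡ P v u
    unique : ∀ v → ∃ λ u → P v u ≡ true × (∀ w → P v w ≡ true → w ≡ u)

Alternating : List Bool → Set
Alternating (b ∷ c ∷ bs) = (b ≡ not c) × Alternating (c ∷ bs)
Alternating _ = ⊤

inPSeq : ∀ {n} {adj : Adj n} (P : Adj n) {s t} → Walk adj s t → List Bool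
inPSeq P w = map (λ e → P (Data.Product.proj₁ e) (Data.Product.proj₂ e)) (edges w)

-- t ∈ A_s : t ≠ s and the (unique, since tree) path from s to t is alternating
-- with first and last edges in P
InA : ∀ {n} → Adj n → Adj n → Fin n → Fin n → Set
InA adj P s t = t ≢ s × Σ (Walk adj s t) λ w →
  IsPath w × Alternating (inPSeq P w) ×
  head (inPSeq P w) ≡ just true × last (inPSeq P w) ≡ just true

HasSize : ∀ {n} → (Fin n → Set) → ℕ → Set
HasSize {n} Q k = Σ (Fin k → Fin n) λ f →
  Injective _≡_ _≡_ f × (∀ i → Q (f i)) × (∀ t → Q t → ∃ λ i → f i ≡ t)

OddType : ∀ {n} → Adj n → Adj n → Fin n → Fin n → Set
OddType adj P s t = ∃ λ a → ∃ λ b →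
  HasSize (InA adj P s) a × HasSize (InA adj P t) b × (a + b) % 2 ≡ 1

EvenType : ∀ {n} → Adj n → Adj n → Fin n → Fin n → Set
EvenType adj P s t = ∃ λ a → ∃ λ b →
  HasSize (InA adj P s) a × HasSize (InA adj P t) b × (a + b) % 2 ≡ 0

-- subdivision of edge xy by a new vertex z = zero; old vertex v becomes suc v
subdivide : ∀ {n} → Adj n → Fin n → Fin n → Adj (suc n)
subdivide adj x y zero zero = false
subdivide adj x y zero (suc j) = ⌊ j ≟ x ⌋ ∨ ⌊ j ≟ y ⌋
subdivide adj x y (suc i) zero = ⌊ i ≟ x ⌋ ∨ ⌊ i ≟ y ⌋
subdivide adj x y (suc i) (suc j) =
  adj i j ∧ not ((⌊ i ≟ x ⌋ ∧ ⌊ j ≟ y ⌋) ∨ (⌊ i ≟ y ⌋ ∧ ⌊ j ≟ x ⌋))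

Config : ℕ → Set
Config n = Fin n → Bool

toggle : ∀ {n} → Adj n → Config n → Fin n → Config n
toggle adj c s v = if adj s v then not (c v) else c v

data Move {n} (adj : Adj n) (c : Config n) : Config n → Set where
  move : (s : Fin n) → c s ≡ true → Move adj c (toggle adj c s)

numOn : ∀ {n} → Config n → ℕ
numOn {n} c = sum (map (λ i → if c i then 1 else 0) (allFin n))

KLit : ∀ {n} → Adj n → ℕ → Set
KLit {n} adj k = ∀ (c : Config n) → ∃ λ d → Star (Move adj) c d × numOn d ≤ k

{-# OPTIONS --safe #-}

-- Over F₂ let B be the alternating form on V = F₂^S with matrix adj and Q the quadratic form with
-- polarisation B and Q(α_s) = 1. Writing a configuration of Γ as B(u, ·), a move at s sends u to u + α_s
-- when B(u, α_s) = 1, and Q is invariant. The perfect matching makes B nondegenerate; the vector dual to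
-- α_s is the indicator of A_s, whose Q-value is the parity of a_s.
-- If some vertex of Γ has degree at least 3, then Γ is obtained from the 6-vertex tree E₆ by attaching
-- matching edges one at a time, and by induction the nonzero orbits on V are the two level sets of Q. On
-- the subdivided tree a configuration is a pair (u, c), c being the state of z, and the moves on u lift.
-- The dual vectors of x and of y give a single lit vertex for either value of c, which settles the odd
-- type; the sum of the dual vectors of x and of a suitable s has the other Q-value and gives two.
-- Otherwise Γ is a path, and so is its subdivision, where two consecutive lights can always be merged.

module Submission where

open import Defs
open import Data.Nat using (ℕ; zero; suc; _+_; _≤_; _<_; _%_; z≤n; s≤s)
open import Data.Nat.ListAction using (sum)
open import Data.Nat.Properties
  using (m≤m+n; n≤1+n; +-suc; +-monoʳ-≤; <⇒≱; ≤-refl; ≤-reflexive; ≤-trans; ≤-<-trans)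
open import Data.Fin using (Fin; zero; suc; _≟_)
open import Data.Fin.Properties using (any?; all?; ¬∀⟶∃¬; suc-injective; injective⇒≤)
open import Data.Bool using (Bool; true; false; not; _∧_; _∨_; _xor_; if_then_else_)
  renaming (_≟_ to _≟ᵇ_)
open import Data.Bool.Properties
  using (∧-zeroʳ; ∧-identityʳ; ∧-comm; xor-identityʳ; xor-same; xor-comm; ¬-not; not-¬;
         not-injective; not-involutive; not-distribˡ-xor)
open import Data.Bool.Solver using (module xor-∧-Solver)
open import Data.List using (List; []; _∷_; _++_; map; length; allFin; lookup; head; last)
open import Data.List.Membership.Propositional using (_∈_; _∉_)
open import Data.List.Membership.Propositional.Properties using (∈-++⁻; ∈-lookup; ∈-map⁺; ∈-map⁻)
open import Data.List.Properties using (map-cong)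
open import Data.List.Relation.Unary.All as All using ([]; _∷_)
open import Data.List.Relation.Unary.AllPairs using ([]; _∷_)
open import Data.List.Relation.Unary.Any using (here; there)
open import Data.List.Relation.Unary.Unique.Propositional using (Unique)
open import Data.List.Relation.Unary.Unique.Propositional.Properties using (++⁺; allFin⁺)
open import Data.Maybe using (just)
open import Data.Maybe.Properties using (just-injective)
open import Data.Product using (∃; _×_; _,_; proj₁; proj₂)
open import Data.Sum using (_⊎_; inj₁; inj₂)
open import Data.Empty using (⊥; ⊥-elim)
open import Data.Unit using (⊤)
open import Function using (_∘_)
open import Relation.Nullary using (¬_; Dec; yes; no; ⌊_⌋)
open import Relation.Nullary.Decidable using (_×-dec_; ¬?; decidable-stable)
open import Relation.Binary.Construct.Closure.ReflexiveTransitive using (Star; ε; _◅_; _◅◅_)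
open import Relation.Binary.PropositionalEquality
  using (_≡_; _≢_; refl; sym; trans; cong; cong₂; subst; _≗_; module ≡-Reasoning)

open xor-∧-Solver using (solve; _:+_; _:*_; _:=_; con)

-- The case split is forced. On a path with six vertices V is the space of even subsets of seven
-- points, and the presses act as the transpositions of consecutive points; two-point and six-point
-- subsets are then separate orbits with the same value of Q. On four vertices there are five
-- points, and Q still tells the two sizes apart. So the induction needs a condition on the vertex q
-- where the next matching edge pℓ is attached. The edge adds to V_C an orthogonal plane, and
-- presses must bring every vector back into V_C. The delicate vectors are u + α_ℓ with u in V_C:
-- one needs a nonzero vector of V_C with the same Q as u, with coefficient 0 at q, and different
-- from the dual vector of q. At an end of the four-vertex path the only even candidate is that dual
-- vector itself; at its inner vertices there are others, and from E₆ on there are others at every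
-- vertex.

private
  false≢true : false ≢ true
  false≢true ()

-- Vectors and sums over F₂.

infixl 6 _⊕_
infixl 7 _·_

_⊕_ : {n : ℕ} → Config n → Config n → Config n
(u ⊕ v) t = u t xor v t

_·_ : {n : ℕ} → Bool → Config n → Config n
(b · u) t = b ∧ u t

𝟘 : {n : ℕ} → Config n
𝟘 _ = false

e : {n : ℕ} → Fin n → Config n
e s t = ⌊ s ≟ t ⌋

e-refl : {n : ℕ} (s : Fin n) → e s s ≡ true
e-refl s with s ≟ s
... | yes _ = refl
... | no s≢s = ⊥-elim (s≢s refl)

e-≢ : {n : ℕ} {s t : Fin n} → s ≢ t → e s t ≡ false
e-≢ {s = s} {t} s≢t with s ≟ t
... | yes s≡t = ⊥-elim (s≢t s≡t)
... | no _ = refl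

e-true : {n : ℕ} {s t : Fin n} → e s t ≡ true → s ≡ t
e-true {s = s} {t} eq with s ≟ t
... | yes s≡t = s≡t

e-sym : {n : ℕ} (s t : Fin n) → e s t ≡ e t s
e-sym s t with s ≟ t
... | yes refl = sym (e-refl s)
... | no s≢t = sym (e-≢ (s≢t ∘ sym))

e-suc : {n : ℕ} (s t : Fin n) → e (suc s) (suc t) ≡ e s t
e-suc s t with s ≟ t
... | yes _ = refl
... | no _ = refl

NZ : {n : ℕ} → Config n → Set
NZ u = ∃ λ t → u t ≡ true

zero? : {n : ℕ} (u : Config n) → NZ u ⊎ u ≗ 𝟘
zero? u with any? (λ t → u t ≟ᵇ true)
... | yes nz = inj₁ nz
... | no ¬nz = inj₂ λ t → ¬-not λ ut → ¬nz (t , ut)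

⊕-cancelʳ : {n : ℕ} (u v : Config n) → u ⊕ v ⊕ v ≗ u
⊕-cancelʳ u v t = solve 2 (λ a b → a :+ b :+ b := a) refl (u t) (v t)

⊕-swapʳ : {n : ℕ} (u v w : Config n) → u ⊕ v ⊕ w ≗ u ⊕ w ⊕ v
⊕-swapʳ u v w t = solve 3 (λ a b c → a :+ b :+ c := a :+ c :+ b) refl (u t) (v t) (w t)

⨁ : {n : ℕ} → (Fin n → Bool) → Bool
⨁ {zero} f = false
⨁ {suc n} f = f zero xor ⨁ (f ∘ suc)

⨁-cong : {n : ℕ} {f g : Fin n → Bool} → f ≗ g → ⨁ f ≡ ⨁ g
⨁-cong {zero} eq = refl
⨁-cong {suc n} eq = cong₂ _xor_ (eq zero) (⨁-cong (eq ∘ suc))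

⨁-⊕ : {n : ℕ} (f g : Fin n → Bool) → ⨁ (f ⊕ g) ≡ ⨁ f xor ⨁ g
⨁-⊕ {zero} f g = refl
⨁-⊕ {suc n} f g rewrite ⨁-⊕ (f ∘ suc) (g ∘ suc) =
  solve 4 (λ a b c d → (a :+ b) :+ (c :+ d) := (a :+ c) :+ (b :+ d)) refl
    (f zero) (g zero) (⨁ (f ∘ suc)) (⨁ (g ∘ suc))

⨁-𝟘 : {n : ℕ} {f : Fin n → Bool} → f ≗ 𝟘 → ⨁ f ≡ false
⨁-𝟘 {zero} eq = refl
⨁-𝟘 {suc n} eq rewrite eq zero = ⨁-𝟘 (eq ∘ suc)

⨁-· : {n : ℕ} (b : Bool) (f : Fin n → Bool) → ⨁ (b · f) ≡ b ∧ ⨁ f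
⨁-· false f = ⨁-𝟘 {f = false · f} λ _ → refl
⨁-· true f = refl

⨁-e : {n : ℕ} (g : Config n) (s : Fin n) → ⨁ (λ t → g t ∧ e s t) ≡ g s
⨁-e {suc n} g zero
  rewrite ∧-identityʳ (g zero) | ⨁-𝟘 {f = λ t → g (suc t) ∧ false} (λ t → ∧-zeroʳ (g (suc t))) =
  xor-identityʳ (g zero)
⨁-e {suc n} g (suc s)
  rewrite ∧-zeroʳ (g zero)
        | ⨁-cong {f = λ t → g (suc t) ∧ e (suc s) (suc t)} {g = λ t → g (suc t) ∧ e s t}
            (λ t → cong (g (suc t) ∧_) (e-suc s t)) = ⨁-e (g ∘ suc) s

⨁-e₁ : {n : ℕ} (s : Fin n) → ⨁ (e s) ≡ true
⨁-e₁ s = ⨁-e (λ _ → true) s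

-- A vector is the sum of its basis vectors only up to pointwise equality, so `R` has to respect
-- `≗`. Serves to prove that `B` is onto.
⊕-induction : {m : ℕ} (R : Config m → Set) → (∀ {u v} → u ≗ v → R u → R v) →
  R 𝟘 → (∀ {u v} → R u → R v → R (u ⊕ v)) → (∀ s → R (e s)) → ∀ u → R u
⊕-induction {m} R resp z add unit u =
  resp (⨁-e u) (sums (λ i t → u i ∧ e t i) λ i → resp (λ t → cong (u i ∧_) (e-sym i t)) (scaled (u i) i))
  where
  scaled : ∀ b i → R (b · e i)
  scaled false i = z
  scaled true i = unit i
  sums : {k : ℕ} (F : Fin k → Config m) → (∀ i → R (F i)) → R (λ t → ⨁ (λ i → F i t))
  sums {zero} F r = z
  sums {suc k} F r = add (r zero) (sums (F ∘ suc) (r ∘ suc))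

-- The bilinear form and the quadratic form.

abstract
  B : {n : ℕ} → Adj n → Config n → Fin n → Bool
  B adj u t = ⨁ (λ i → u i ∧ adj i t)

  BB : {n : ℕ} → Adj n → Config n → Config n → Bool
  BB adj u v = ⨁ (λ t → v t ∧ B adj u t)

  B-def : {n : ℕ} (adj : Adj n) (u : Config n) (t : Fin n) → B adj u t ≡ ⨁ (λ i → u i ∧ adj i t)
  B-def adj u t = refl

  BB-def : {n : ℕ} (adj : Adj n) (u v : Config n) → BB adj u v ≡ ⨁ (λ t → v t ∧ B adj u t)
  BB-def adj u v = refl

  -- The quadratic form u ↦ (vertices of u) + (edges inside u) mod 2, whose polarisation is BB.
  Q : {n : ℕ} → Adj n → Config n → Bool
  Q {zero} adj u = false
  Q {suc n} adj u =
    (u zero ∧ (true xor ⨁ (λ i → u (suc i) ∧ adj zero (suc i))))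
      xor Q (λ i j → adj (suc i) (suc j)) (u ∘ suc)

  B-⊕ : {n : ℕ} (adj : Adj n) (u v : Config n) (t : Fin n) → B adj (u ⊕ v) t ≡ B adj u t xor B adj v t
  B-⊕ adj u v t = trans
    (⨁-cong λ i → solve 3 (λ a b c → (a :+ b) :* c := a :* c :+ b :* c) refl (u i) (v i) (adj i t))
    (⨁-⊕ (λ i → u i ∧ adj i t) (λ i → v i ∧ adj i t))

  B-cong : {n : ℕ} (adj : Adj n) {u v : Config n} → u ≗ v → ∀ t → B adj u t ≡ B adj v t
  B-cong adj eq t = ⨁-cong λ i → cong (_∧ adj i t) (eq i)

  B-𝟘 : {n : ℕ} (adj : Adj n) {u : Config n} → u ≗ 𝟘 → ∀ t → B adj u t ≡ false
  B-𝟘 adj eq t = ⨁-𝟘 λ i → cong (_∧ adj i t) (eq i)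

  B-e : {n : ℕ} (adj : Adj n) (s t : Fin n) → B adj (e s) t ≡ adj s t
  B-e adj s t = trans (⨁-cong λ i → ∧-comm (e s i) (adj i t)) (⨁-e (λ i → adj i t) s)

  Q-cong : {n : ℕ} (adj : Adj n) {u v : Config n} → u ≗ v → Q adj u ≡ Q adj v
  Q-cong {zero} adj eq = refl
  Q-cong {suc n} adj {u} {v} eq
    rewrite eq zero | Q-cong (λ i j → adj (suc i) (suc j)) {u ∘ suc} {v ∘ suc} (eq ∘ suc)
          | ⨁-cong {f = λ i → u (suc i) ∧ adj zero (suc i)} {g = λ i → v (suc i) ∧ adj zero (suc i)}
              (λ i → cong (_∧ adj zero (suc i)) (eq (suc i))) = refl

  Q-𝟘 : {n : ℕ} (adj : Adj n) {u : Config n} → u ≗ 𝟘 → Q adj u ≡ false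
  Q-𝟘 {zero} adj eq = refl
  Q-𝟘 {suc n} adj eq rewrite eq zero = Q-𝟘 (λ i j → adj (suc i) (suc j)) (eq ∘ suc)

  -- Splitting off vertex zero leaves two cross terms, `v zero ∧ L u′` and `u zero ∧ L v′`: the
  -- contributions to `BB` in which zero is the second or the first index. Irreflexivity removes the
  -- diagonal one.
  Q-⊕ : {n : ℕ} {adj : Adj n} → IsSimple adj → (u v : Config n) →
    Q adj (u ⊕ v) ≡ (Q adj u xor Q adj v) xor BB adj u v
  Q-⊕ {zero} simple u v = refl
  Q-⊕ {suc n} {adj} simple u v = begin
    ((u zero xor v zero) ∧ (true xor ⨁ (λ i → (u (suc i) xor v (suc i)) ∧ adj zero (suc i))))
      xor Q adj′ (u′ ⊕ v′)
      ≡⟨ cong₂ (λ l q → ((u zero xor v zero) ∧ (true xor l)) xor q)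
           (trans (⨁-cong λ i → distrib (u′ i) (v′ i) (adj zero (suc i)))
                  (⨁-⊕ (λ i → u′ i ∧ adj zero (suc i)) (λ i → v′ i ∧ adj zero (suc i))))
           (Q-⊕ simple′ u′ v′) ⟩
    ((u zero xor v zero) ∧ (true xor (L u′ xor L v′))) xor ((Q adj′ u′ xor Q adj′ v′) xor BB adj′ u′ v′)
      ≡⟨ solve 7 (λ u₀ v₀ lu lv qu qv b →
           ((u₀ :+ v₀) :* (con true :+ (lu :+ lv))) :+ ((qu :+ qv) :+ b) :=
           (((u₀ :* (con true :+ lu)) :+ qu) :+ ((v₀ :* (con true :+ lv)) :+ qv)) :+
             (v₀ :* lu :+ (u₀ :* lv :+ b)))
           refl (u zero) (v zero) (L u′) (L v′) (Q adj′ u′) (Q adj′ v′) (BB adj′ u′ v′) ⟩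
    (Q adj u xor Q adj v) xor ((v zero ∧ L u′) xor ((u zero ∧ L v′) xor BB adj′ u′ v′))
      ≡⟨ cong ((Q adj u xor Q adj v) xor_) (sym (cong₂ (λ a b → (v zero ∧ a) xor b) at-zero at-suc)) ⟩
    (Q adj u xor Q adj v) xor BB adj u v ∎
    where
    open ≡-Reasoning
    u′ v′ : Config n
    u′ = u ∘ suc
    v′ = v ∘ suc
    adj′ : Adj n
    adj′ i j = adj (suc i) (suc j)
    simple′ : IsSimple adj′
    simple′ = record { sym = λ i j → IsSimple.sym simple (suc i) (suc j)
                     ; irrefl = λ i → IsSimple.irrefl simple (suc i) }
    L : Config n → Bool
    L w = ⨁ (λ i → w i ∧ adj zero (suc i))
    distrib : ∀ a b c → (a xor b) ∧ c ≡ (a ∧ c) xor (b ∧ c)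
    distrib = solve 3 (λ a b c → (a :+ b) :* c := a :* c :+ b :* c) refl
    at-zero : B adj u zero ≡ L u′
    at-zero rewrite IsSimple.irrefl simple zero | ∧-zeroʳ (u zero) =
      ⨁-cong λ i → cong (u′ i ∧_) (IsSimple.sym simple (suc i) zero)
    at-suc : ⨁ (λ t → v′ t ∧ B adj u (suc t)) ≡ (u zero ∧ L v′) xor BB adj′ u′ v′
    at-suc = trans
      (⨁-cong λ t → solve 4 (λ a b c d → a :* (b :* c :+ d) := b :* (a :* c) :+ a :* d) refl
         (v′ t) (u zero) (adj zero (suc t)) (B adj′ u′ t))
      (trans (⨁-⊕ (λ t → u zero ∧ (v′ t ∧ adj zero (suc t))) (λ t → v′ t ∧ B adj′ u′ t))
             (cong (_xor BB adj′ u′ v′) (⨁-· (u zero) (λ t → v′ t ∧ adj zero (suc t)))))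
  Q-e : {n : ℕ} (adj : Adj n) (s : Fin n) → Q adj (e s) ≡ true
  Q-e {suc n} adj zero
    rewrite ⨁-𝟘 {n} {λ i → false ∧ adj zero (suc i)} (λ _ → refl)
          | Q-𝟘 (λ i j → adj (suc i) (suc j)) {e zero ∘ suc} (λ _ → refl) = refl
  Q-e {suc n} adj (suc s) =
    trans (Q-cong (λ i j → adj (suc i) (suc j)) (e-suc s)) (Q-e (λ i j → adj (suc i) (suc j)) s)

-- Reachability by presses and dual vectors.

module Forms {n : ℕ} (adj : Adj n) (simple : IsSimple adj) where

  BB-e : ∀ u s → BB adj u (e s) ≡ B adj u s
  BB-e u s = trans (BB-def adj u (e s)) (trans (⨁-cong λ t → ∧-comm (e s t) (B adj u t)) (⨁-e (B adj u) s))

  Q-⊕e : ∀ u s → Q adj (u ⊕ e s) ≡ (true xor Q adj u) xor B adj u s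
  Q-⊕e u s rewrite Q-⊕ simple u (e s) | Q-e adj s | BB-e u s =
    solve 2 (λ a b → (a :+ con true) :+ b := (con true :+ a) :+ b) refl (Q adj u) (B adj u s)

  BB-alt : ∀ u → BB adj u u ≡ false
  BB-alt u = trans
    (solve 2 (λ q b → b := (q :+ q) :+ b) refl (Q adj u) (BB adj u u))
    (trans (sym (Q-⊕ simple u u)) (Q-𝟘 adj λ t → xor-same (u t)))

  -- Read off from the polarisation identity, as `u ⊕ v` and `v ⊕ u` agree pointwise; this replaces
  -- an interchange of double sums.
  BB-sym : ∀ u v → BB adj u v ≡ BB adj v u
  BB-sym u v = trans (move-Q (Q-⊕ simple u v))
    (trans (cong₂ _xor_ (Q-cong adj (λ t → xor-comm (u t) (v t))) (xor-comm (Q adj u) (Q adj v)))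
           (sym (move-Q (Q-⊕ simple v u))))
    where
    move-Q : ∀ {a b c} → a ≡ b xor c → c ≡ a xor b
    move-Q {b = b} {c} refl = solve 2 (λ b c → c := (b :+ c) :+ b) refl b c

  B-self : ∀ s → B adj (e s) s ≡ false
  B-self s = trans (B-e adj s s) (IsSimple.irrefl simple s)

  -- The subspace V_C spanned by the `e t` with `t` in `C`. As a support condition it lets `C` grow
  -- inside one fixed ambient space.
  InV : List (Fin n) → Config n → Set
  InV C u = ∀ {t} → t ∉ C → u t ≡ false

  inV-⊕ : ∀ {C u v} → InV C u → InV C v → InV C (u ⊕ v)
  inV-⊕ iu iv t∉ rewrite iu t∉ | iv t∉ = refl

  inV-· : ∀ {C u} b → InV C u → InV C (b · u)
  inV-· b iu t∉ rewrite iu t∉ = ∧-zeroʳ b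

  inV-e : ∀ {C s} → s ∈ C → InV C (e s)
  inV-e s∈ t∉ = e-≢ λ { refl → t∉ s∈ }

  inV-⊆ : ∀ {C D u} → (∀ {t} → t ∈ C → t ∈ D) → InV C u → InV D u
  inV-⊆ C⊆D iu t∉ = iu (t∉ ∘ C⊆D)

  -- The game on Γ seen on the vectors `u` that represent configurations `B adj u`, with presses
  -- confined to `C`.
  data Reach (C : List (Fin n)) : Config n → Config n → Set where
    done  : ∀ {u v} → u ≗ v → Reach C u v
    press : ∀ {u v} s → s ∈ C → B adj u s ≡ true → Reach C (u ⊕ e s) v → Reach C u v

  module _ {C : List (Fin n)} where

    reach-≗ˡ : ∀ {u u′ v} → u ≗ u′ → Reach C u′ v → Reach C u v
    reach-≗ˡ eq (done eq′) = done λ t → trans (eq t) (eq′ t)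
    reach-≗ˡ eq (press s s∈ b r) =
      press s s∈ (trans (B-cong adj eq s) b) (reach-≗ˡ (λ t → cong (_xor e s t) (eq t)) r)

    reach-trans : ∀ {u v w} → Reach C u v → Reach C v w → Reach C u w
    reach-trans (done eq) r′ = reach-≗ˡ eq r′
    reach-trans (press s s∈ b r) r′ = press s s∈ b (reach-trans r r′)

    -- A press is an involution: `s` is not its own neighbour, so it stays lit and can be pressed
    -- again.
    reach-sym : ∀ {u v} → Reach C u v → Reach C v u
    reach-sym (done eq) = done (sym ∘ eq)
    reach-sym {u} (press s s∈ b r) = reach-trans (reach-sym r)
      (press s s∈ still-lit (done (⊕-cancelʳ u (e s))))
      where
      still-lit : B adj (u ⊕ e s) s ≡ true
      still-lit = trans (B-⊕ adj u (e s) s) (cong₂ _xor_ b (B-self s))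

    reach-Q : ∀ {u v} → Reach C u v → Q adj u ≡ Q adj v
    reach-Q (done eq) = Q-cong adj eq
    reach-Q {u} (press s s∈ b r) = trans
      (trans (solve 1 (λ q → q := (con true :+ q) :+ con true) refl (Q adj u))
             (cong ((true xor Q adj u) xor_) (sym b)))
      (trans (sym (Q-⊕e u s)) (reach-Q r))

    -- A summand orthogonal to all of V_C has no influence on which vertices of `C` are lit, so it
    -- is carried along unchanged.
    reach-shift : ∀ {u v} h → (∀ {s} → s ∈ C → B adj h s ≡ false) →
      Reach C u v → Reach C (u ⊕ h) (v ⊕ h)
    reach-shift h h⊥ (done eq) = done λ t → cong (_xor h t) (eq t)
    reach-shift {u} h h⊥ (press s s∈ b r) = press s s∈
      (trans (B-⊕ adj u h s) (cong₂ _xor_ b (h⊥ s∈)))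
      (reach-≗ˡ (⊕-swapʳ u h (e s)) (reach-shift h h⊥ r))

  reach-⊆ : ∀ {C D u v} → (∀ {t} → t ∈ C → t ∈ D) → Reach C u v → Reach D u v
  reach-⊆ C⊆D (done eq) = done eq
  reach-⊆ C⊆D (press s s∈ b r) = press s (C⊆D s∈) b (reach-⊆ C⊆D r)

  -- The vector of V_C that represents the coordinate at `q` through the form; as `C` varies over a
  -- matched part, these are the rows of the inverse adjacency matrix.
  record Dual (C : List (Fin n)) (q : Fin n) (w : Config n) : Set where
    field
      inV  : InV C w
      eval : ∀ {t} → t ∈ C → B adj w t ≡ e q t

  dual-BB : ∀ {C q w u} → Dual C q w → InV C u → BB adj w u ≡ u q
  dual-BB {C} {q} {w} {u} d iu = trans (BB-def adj w u) (trans (⨁-cong terms) (⨁-e u q))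
    where
    open import Data.List.Membership.DecPropositional (_≟_ {n}) using (_∈?_)
    terms : ∀ t → u t ∧ B adj w t ≡ u t ∧ e q t
    terms t with t ∈? C
    ... | yes t∈ = cong (u t ∧_) (Dual.eval d t∈)
    ... | no t∉ rewrite iu t∉ = refl

  dual-diag : ∀ {C q w} → Dual C q w → w q ≡ false
  dual-diag d = trans (sym (dual-BB d (Dual.inV d))) (BB-alt _)

  -- Both entries equal the pairing of `w` with `v`: the inverse of a symmetric matrix is symmetric.
  dual-sym : ∀ {C q s w v} → Dual C q w → Dual C s v → v q ≡ w s
  dual-sym {w = w} {v} d d′ =
    trans (sym (dual-BB d (Dual.inV d′))) (trans (BB-sym w v) (dual-BB d′ (Dual.inV d)))

  -- Attaching a matching edge.

  record Attach (C : List (Fin n)) (q p ℓ : Fin n) : Set where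
    field
      q∈C   : q ∈ C
      p∉C   : p ∉ C
      ℓ∉C   : ℓ ∉ C
      p~ℓ   : adj p ℓ ≡ true
      p~q   : adj p q ≡ true
      p-nbr : ∀ {t} → t ∈ C → adj p t ≡ true → t ≡ q
      ℓ-nbr : ∀ {t} → t ∈ C → adj ℓ t ≡ false

  -- Full C: the orbits on nonzero vectors of V_C are exactly the level sets of Q.
  Full : List (Fin n) → Set
  Full C = ∀ {u v} → InV C u → InV C v → NZ u → NZ v → Q adj u ≡ Q adj v → Reach C u v

  module Attached {C : List (Fin n)} {q p ℓ : Fin n} (att : Attach C q p ℓ) where
    open Attach att public

    C′ : List (Fin n)
    C′ = p ∷ ℓ ∷ C

    C⊆C′ : ∀ {t} → t ∈ C → t ∈ C′
    C⊆C′ = there ∘ there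

    p≢ℓ : p ≢ ℓ
    p≢ℓ refl = false≢true (trans (sym (IsSimple.irrefl simple p)) p~ℓ)

    ℓ~p : adj ℓ p ≡ true
    ℓ~p = trans (IsSimple.sym simple ℓ p) p~ℓ

    adj-p : ∀ {t} → t ∈ C → adj p t ≡ e q t
    adj-p {t} t∈ with q ≟ t
    ... | yes refl = p~q
    ... | no q≢t = ¬-not λ p~t → q≢t (sym (p-nbr t∈ p~t))

    ∉C′ : ∀ {t} → t ≢ p → t ≢ ℓ → t ∉ C → t ∉ C′
    ∉C′ t≢p t≢ℓ t∉ (here eq) = t≢p eq
    ∉C′ t≢p t≢ℓ t∉ (there (here eq)) = t≢ℓ eq
    ∉C′ t≢p t≢ℓ t∉ (there (there t∈)) = t∉ t∈

    open import Data.List.Membership.DecPropositional (_≟_ {n}) using (_∈?_)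

    B-p : ∀ {u} → InV C u → B adj u p ≡ u q
    B-p {u} iu = trans (B-def adj u p) (trans (⨁-cong terms) (⨁-e u q))
      where
      terms : ∀ i → u i ∧ adj i p ≡ u i ∧ e q i
      terms i with i ∈? C
      ... | yes i∈ = cong (u i ∧_) (trans (IsSimple.sym simple i p) (adj-p i∈))
      ... | no i∉ rewrite iu i∉ = refl

    B-ℓ : ∀ {u} → InV C u → B adj u ℓ ≡ false
    B-ℓ {u} iu = trans (B-def adj u ℓ) (⨁-𝟘 terms)
      where
      terms : ∀ i → u i ∧ adj i ℓ ≡ false
      terms i with i ∈? C
      ... | yes i∈ = trans (cong (u i ∧_) (trans (IsSimple.sym simple i ℓ) (ℓ-nbr i∈))) (∧-zeroʳ (u i))
      ... | no i∉ rewrite iu i∉ = refl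

    module Reduction {w : Config n} (dual : Dual C q w) where
      open Dual dual renaming (inV to w∈V; eval to B-w)

      -- The part of `e p` orthogonal to V_C. It pairs to 1 with `e ℓ`, which is also orthogonal to
      -- V_C, so V_C′ is the orthogonal sum of V_C and the plane spanned by `p̂` and `e ℓ`.
      p̂ : Config n
      p̂ = e p ⊕ w

      B-p̂ : ∀ {s} → s ∈ C → B adj p̂ s ≡ false
      B-p̂ {s} s∈ rewrite B-⊕ adj (e p) w s | B-e adj p s | B-w s∈ | adj-p s∈ = xor-same (e q s)

      B-p̂p : B adj p̂ p ≡ false
      B-p̂p rewrite B-⊕ adj (e p) w p | B-self p | B-p w∈V = dual-diag dual

      B-p̂ℓ : B adj p̂ ℓ ≡ true
      B-p̂ℓ rewrite B-⊕ adj (e p) w ℓ | B-e adj p ℓ | p~ℓ | B-ℓ w∈V = refl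

      w-nz : NZ w
      w-nz with zero? w
      ... | inj₁ nz = nz
      ... | inj₂ w≗𝟘 = ⊥-elim (false≢true
        (trans (sym (B-𝟘 adj w≗𝟘 q)) (trans (B-w q∈C) (e-refl q))))

      -- The target `T` is left open because the four-vertex path has to accept a representative
      -- outside V_C.
      Reduces : (Config n → Set) → Config n → Set
      Reduces T u = ∃ λ v → Reach C′ u v × T v

      reduce-via : ∀ {T u v} → Reach C′ u v → Reduces T v → Reduces T u
      reduce-via r (v , r′ , t) = v , reach-trans r r′ , t

      module _ (full : Full C)
        (r₁ : ∀ {u} → InV C u → NZ u → ∃ λ v → InV C v × v q ≡ true × Q adj v ≡ Q adj u)
        (T : Config n → Set) (T-V : ∀ {v} → InV C v → NZ v → T v) where

        -- Presses inside `C` do not disturb `p̂`, so transitivity on V_C makes the coefficient at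
        -- `q` equal to 1. Then `p` is lit, and pressing it turns `p̂` into `w`, since `p̂ ⊕ e p` is
        -- `w`.
        reduce-p̂ : ∀ {u} → InV C u → NZ u → Reduces T (u ⊕ p̂)
        reduce-p̂ {u} iu nz with r₁ iu nz
        ... | v , iv , vq , Qv =
          v ⊕ w
          , reach-trans (reach-⊆ C⊆C′ (reach-shift p̂ B-p̂ (full iu iv nz (q , vq) (sym Qv))))
              (press p (here refl) lit (done λ t →
                solve 3 (λ a b c → (a :+ (b :+ c)) :+ b := a :+ c) refl (v t) (e p t) (w t)))
          , T-V (inV-⊕ iv w∈V) (q , cong₂ _xor_ vq (dual-diag dual))
          where
          lit : B adj (v ⊕ p̂) p ≡ true
          lit rewrite B-⊕ adj v p̂ p | B-p iv | B-p̂p | vq = refl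

        module _ (hℓ : ∀ {u} → InV C u → NZ u → Reduces T (u ⊕ e ℓ)) where

          -- The bare vector `e ℓ` is outside the scope of `hℓ`; pressing `p` and then `ℓ` turns it
          -- into `e p`, which is `w ⊕ p̂` with `w` nonzero.
          reduce-ℓ : ∀ {u} → InV C u → Reduces T (u ⊕ e ℓ)
          reduce-ℓ {u} iu with zero? u
          ... | inj₁ nz = hℓ iu nz
          ... | inj₂ u≗𝟘 = reduce-via
            (press p (here refl) lit-p (press ℓ (there (here refl)) lit-ℓ (done λ t →
              trans (cong (λ a → ((a xor e ℓ t) xor e p t) xor e ℓ t) (u≗𝟘 t))
                (solve 3 (λ a b c → (con false :+ a :+ b) :+ a := c :+ (b :+ c)) refl
                  (e ℓ t) (e p t) (w t)))))
            (reduce-p̂ w∈V w-nz)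
            where
            lit-p : B adj (u ⊕ e ℓ) p ≡ true
            lit-p rewrite B-⊕ adj u (e ℓ) p | B-𝟘 adj u≗𝟘 p | B-e adj ℓ p = ℓ~p
            lit-ℓ : B adj (u ⊕ e ℓ ⊕ e p) ℓ ≡ true
            lit-ℓ rewrite B-⊕ adj (u ⊕ e ℓ) (e p) ℓ | B-⊕ adj u (e ℓ) ℓ | B-𝟘 adj u≗𝟘 ℓ
              | B-self ℓ | B-e adj p ℓ = p~ℓ

          -- The bare vector `p̂` becomes `w ⊕ e ℓ` by pressing `ℓ` and then `p`.
          reduce-p̂₀ : ∀ {u} → InV C u → Reduces T (u ⊕ p̂)
          reduce-p̂₀ {u} iu with zero? u
          ... | inj₁ nz = reduce-p̂ iu nz
          ... | inj₂ u≗𝟘 = reduce-via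
            (press ℓ (there (here refl)) lit-ℓ (press p (here refl) lit-p (done λ t →
              trans (cong (λ a → ((a xor (e p t xor w t)) xor e ℓ t) xor e p t) (u≗𝟘 t))
                (solve 3 (λ a b c → (con false :+ (b :+ c) :+ a) :+ b := c :+ a) refl
                  (e ℓ t) (e p t) (w t)))))
            (hℓ w∈V w-nz)
            where
            lit-ℓ : B adj (u ⊕ p̂) ℓ ≡ true
            lit-ℓ rewrite B-⊕ adj u p̂ ℓ | B-𝟘 adj u≗𝟘 ℓ = B-p̂ℓ
            lit-p : B adj (u ⊕ p̂ ⊕ e ℓ) p ≡ true
            lit-p rewrite B-⊕ adj (u ⊕ p̂) (e ℓ) p | B-⊕ adj u p̂ p | B-𝟘 adj u≗𝟘 p
              | B-p̂p | B-e adj ℓ p = ℓ~p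

          -- As `w` vanishes at `p` and `ℓ`, the coefficients of `u` along `p̂` and `e ℓ` are `u p`
          -- and `u ℓ`. If both are 1, then `ℓ` is lit and one press removes `e ℓ`.
          reduce : ∀ {u} → InV C′ u → NZ u → Reduces T u
          reduce {u} iu nz = split (u p) (u ℓ) refl refl
            where
            core : Bool → Bool → Config n
            core a b = u ⊕ a · p̂ ⊕ b · e ℓ

            core∈V : ∀ {a b} → u p ≡ a → u ℓ ≡ b → InV C (core a b)
            core∈V {a} {b} up uℓ {t} t∉ with t ≟ p | t ≟ ℓ
            ... | yes refl | _ rewrite up | e-refl p | w∈V p∉C | e-≢ (p≢ℓ ∘ sym) =
              solve 2 (λ a b → a :+ a :* con true :+ b :* con false := con false) refl a b
            ... | no _ | yes refl rewrite uℓ | e-≢ p≢ℓ | w∈V ℓ∉C | e-refl ℓ =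
              solve 2 (λ a b → b :+ a :* con false :+ b :* con true := con false) refl a b
            ... | no t≢p | no t≢ℓ rewrite iu (∉C′ t≢p t≢ℓ t∉) | e-≢ (t≢p ∘ sym) | e-≢ (t≢ℓ ∘ sym) | w∈V t∉ =
              solve 2 (λ a b → con false :+ a :* con false :+ b :* con false := con false) refl a b

            split : ∀ a b → u p ≡ a → u ℓ ≡ b → Reduces T u
            split false false up uℓ = u , done (λ _ → refl) , T-V u∈V nz
              where
              u∈V : InV C u
              u∈V {t} t∉ = trans (solve 1 (λ a → a := a :+ con false :+ con false) refl (u t))
                (core∈V up uℓ t∉)
            split true false up uℓ = reduce-via
              (done λ t → solve 2 (λ a b → a := (a :+ b :+ con false) :+ b) refl (u t) (p̂ t))
              (reduce-p̂₀ (core∈V up uℓ))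
            split false true up uℓ = reduce-via
              (done λ t → solve 2 (λ a b → a := (a :+ con false :+ b) :+ b) refl (u t) (e ℓ t))
              (reduce-ℓ (core∈V up uℓ))
            split true true up uℓ = reduce-via
              (press ℓ (there (here refl)) lit (done λ t →
                solve 3 (λ a b c → a :+ c := (a :+ b :+ c) :+ b) refl (u t) (p̂ t) (e ℓ t)))
              (reduce-p̂₀ (core∈V up uℓ))
              where
              lit : B adj u ℓ ≡ true
              lit = trans (B-cong adj (λ t →
                  solve 3 (λ a b c → a := (a :+ b :+ c) :+ b :+ c) refl (u t) (p̂ t) (e ℓ t)) ℓ)
                (trans (B-⊕ adj (core true true ⊕ p̂) (e ℓ) ℓ)
                  (trans (cong₂ _xor_ (trans (B-⊕ adj (core true true) p̂ ℓ)
                      (cong₂ _xor_ (B-ℓ (core∈V up uℓ)) B-p̂ℓ)) (B-self ℓ)) refl))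

-- Transitivity on the level sets of Q, from a pair up to E₆ and beyond.

module Transitivity {n : ℕ} (adj : Adj n) (simple : IsSimple adj) where
  open Forms adj simple

  adj⇒≢ : ∀ {s t} → adj s t ≡ true → s ≢ t
  adj⇒≢ {s} s~t refl = false≢true (trans (sym (IsSimple.irrefl simple s)) s~t)

  adj-sym : ∀ {s t b} → adj s t ≡ b → adj t s ≡ b
  adj-sym {s} {t} s~t = trans (IsSimple.sym simple t s) s~t

  Q-e⊕e : ∀ s t → Q adj (e s ⊕ e t) ≡ adj s t
  Q-e⊕e s t = trans (Q-⊕e (e s) t) (trans
    (cong (λ a → (true xor a) xor B adj (e s) t) (Q-e adj s)) (B-e adj s t))

  dual-pair : ∀ {a b} → adj a b ≡ true → Dual (a ∷ b ∷ []) a (e b)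
  dual-pair {a} {b} a~b = record
    { inV = inV-e (there (here refl))
    ; eval = λ { (here refl) → trans (B-e adj b a) (trans (adj-sym a~b) (sym (e-refl a)))
               ; (there (here refl)) → trans (B-self b) (sym (e-≢ (adj⇒≢ a~b))) } }

  -- V_C has three nonzero vectors; pressing `b` leads from `e a` to `e a ⊕ e b`, and pressing `a`
  -- leads on to `e b`.
  pair-reach : ∀ {a b u} → adj a b ≡ true → InV (a ∷ b ∷ []) u → NZ u → Reach (a ∷ b ∷ []) u (e b)
  pair-reach {a} {b} {u} a~b iu (t , ut) = split (u a) (u b) refl refl
    where
    a≢b : a ≢ b
    a≢b = adj⇒≢ a~b
    expand : ∀ {x y} → u a ≡ x → u b ≡ y → u ≗ x · e a ⊕ y · e b
    expand {x} {y} ua ub t with t ≟ a | t ≟ b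
    ... | yes refl | _ rewrite ua | e-refl t | e-≢ (a≢b ∘ sym) =
      solve 2 (λ x y → x := x :* con true :+ y :* con false) refl x y
    ... | no _ | yes refl rewrite ub | e-≢ a≢b | e-refl t =
      solve 2 (λ x y → y := x :* con false :+ y :* con true) refl x y
    ... | no t≢a | no t≢b
      rewrite iu {t} (λ { (here eq) → t≢a eq ; (there (here eq)) → t≢b eq })
            | e-≢ (t≢a ∘ sym) | e-≢ (t≢b ∘ sym) =
      solve 2 (λ x y → con false := x :* con false :+ y :* con false) refl x y
    lit-a : adj b a ≡ true
    lit-a = adj-sym a~b
    from-ab : ∀ {v} → v ≗ e a ⊕ e b → Reach (a ∷ b ∷ []) v (e b)
    from-ab {v} eq = press a (here refl)
      (trans (B-cong adj eq a) (trans (B-⊕ adj (e a) (e b) a)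
        (cong₂ _xor_ (B-self a) (trans (B-e adj b a) lit-a))))
      (done λ t → trans (cong (_xor e a t) (eq t))
        (solve 2 (λ x y → x :+ y :+ x := y) refl (e a t) (e b t)))
    split : ∀ x y → u a ≡ x → u b ≡ y → Reach (a ∷ b ∷ []) u (e b)
    split false false ua ub = ⊥-elim (false≢true (trans (sym (expand ua ub t)) ut))
    split false true ua ub = done (expand ua ub)
    split true true ua ub = from-ab (expand ua ub)
    split true false ua ub = press b (there (here refl))
      (trans (B-cong adj u≗ea b) (trans (B-e adj a b) a~b))
      (from-ab λ t → cong (_xor e b t) (u≗ea t))
      where
      u≗ea : u ≗ e a
      u≗ea t = trans (expand ua ub t) (xor-identityʳ (e a t))

  pair-full : ∀ {a b} → adj a b ≡ true → Full (a ∷ b ∷ [])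
  pair-full a~b iu iv nzu nzv _ = reach-trans (pair-reach a~b iu nzu) (reach-sym (pair-reach a~b iv nzv))

  -- A stock of vertices for building test vectors: `e q ⊕ e z` is even with coefficient 1 at `q`,
  -- while `e s₁`, `e s₂` are odd and `e r ⊕ e s₁`, `e r ⊕ e s₂` are even with coefficient 0 there.
  record Rich (C : List (Fin n)) (q : Fin n) : Set where
    field
      {z r s₁ s₂} : Fin n
      z∈  : z ∈ C
      r∈  : r ∈ C
      s₁∈ : s₁ ∈ C
      s₂∈ : s₂ ∈ C
      z≢q  : z ≢ q
      r≢q  : r ≢ q
      s₁≢q : s₁ ≢ q
      s₂≢q : s₂ ≢ q
      r≢s₁ : r ≢ s₁
      r≢s₂ : r ≢ s₂
      s₁≢s₂ : s₁ ≢ s₂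
      q≁z  : adj q z ≡ false
      r≁s₁ : adj r s₁ ≡ false
      r≁s₂ : adj r s₂ ≡ false

  Big : List (Fin n) → Set
  Big C = ∀ {q} → q ∈ C → ∃ λ t₁ → ∃ λ t₂ → t₁ ∈ C × t₂ ∈ C × t₁ ≢ q × t₂ ≢ q × t₁ ≢ t₂

  rich-lit : ∀ {C q} → q ∈ C → Rich C q → ∀ {u} → InV C u → NZ u →
    ∃ λ v → InV C v × v q ≡ true × Q adj v ≡ Q adj u
  rich-lit {C} {q} q∈ rich {u} _ _ with Q adj u
  ... | true = e q , inV-e q∈ , e-refl q , Q-e adj q
  ... | false = e q ⊕ e z , inV-⊕ (inV-e q∈) (inV-e z∈) , cong₂ _xor_ (e-refl q) (e-≢ z≢q)
    , trans (Q-e⊕e q z) q≁z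
    where open Rich rich

  -- Two candidates differing at s₁, at least one of which differs from w.
  rich-unlit : ∀ {C q} → Rich C q → ∀ β w →
    ∃ λ v → InV C v × v q ≡ false × Q adj v ≡ β × NZ v × NZ (v ⊕ w)
  rich-unlit {C} {q} rich β w = choose β (w s₁) refl
    where
    open Rich rich
    Candidate : Bool → Config n → Set
    Candidate β v = InV C v × v q ≡ false × Q adj v ≡ β × NZ v × NZ (v ⊕ w)
    choose : ∀ β b → w s₁ ≡ b → ∃ (Candidate β)
    choose true false ws = e s₁ , inV-e s₁∈ , e-≢ s₁≢q , Q-e adj s₁ , (s₁ , e-refl s₁)
      , (s₁ , cong₂ _xor_ (e-refl s₁) ws)
    choose true true ws = e s₂ , inV-e s₂∈ , e-≢ s₂≢q , Q-e adj s₂ , (s₂ , e-refl s₂)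
      , (s₁ , cong₂ _xor_ (e-≢ (s₁≢s₂ ∘ sym)) ws)
    choose false false ws = e r ⊕ e s₁ , inV-⊕ (inV-e r∈) (inV-e s₁∈)
      , cong₂ _xor_ (e-≢ r≢q) (e-≢ s₁≢q) , trans (Q-e⊕e r s₁) r≁s₁
      , (s₁ , cong₂ _xor_ (e-≢ r≢s₁) (e-refl s₁))
      , (s₁ , cong₂ _xor_ (cong₂ _xor_ (e-≢ r≢s₁) (e-refl s₁)) ws)
    choose false true ws = e r ⊕ e s₂ , inV-⊕ (inV-e r∈) (inV-e s₂∈)
      , cong₂ _xor_ (e-≢ r≢q) (e-≢ s₂≢q) , trans (Q-e⊕e r s₂) r≁s₂
      , (s₂ , cong₂ _xor_ (e-≢ r≢s₂) (e-refl s₂))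
      , (s₁ , cong₂ _xor_ (cong₂ _xor_ (e-≢ r≢s₁) (e-≢ (s₁≢s₂ ∘ sym))) ws)

  module _ {C : List (Fin n)} {q p ℓ : Fin n} (att : Attach C q p ℓ) where
    open Attached att

    attach-big : Big C′
    attach-big (here refl) = ℓ , q , there (here refl) , C⊆C′ q∈C , (p≢ℓ ∘ sym)
      , (λ { refl → p∉C q∈C }) , λ { refl → ℓ∉C q∈C }
    attach-big (there (here refl)) = p , q , here refl , C⊆C′ q∈C , p≢ℓ
      , (λ { refl → ℓ∉C q∈C }) , λ { refl → p∉C q∈C }
    attach-big (there (there t∈)) = p , ℓ , here refl , there (here refl)
      , (λ { refl → p∉C t∈ }) , (λ { refl → ℓ∉C t∈ }) , p≢ℓ

    -- Old vertices are never adjacent to `ℓ`, and those other than `q` are not adjacent to `p`. So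
    -- `ℓ` plays the role of `r` everywhere except at `ℓ` itself, where `p` does.
    attach-rich : Big C → ∀ {t} → t ∈ C′ → Rich C′ t
    attach-rich big (here refl) with big q∈C
    ... | t₁ , t₂ , t₁∈ , t₂∈ , t₁≢q , t₂≢q , t₁≢t₂ = record
      { z∈ = C⊆C′ t₁∈ ; r∈ = there (here refl) ; s₁∈ = C⊆C′ t₁∈ ; s₂∈ = C⊆C′ t₂∈
      ; z≢q = λ { refl → p∉C t₁∈ } ; r≢q = p≢ℓ ∘ sym
      ; s₁≢q = λ { refl → p∉C t₁∈ } ; s₂≢q = λ { refl → p∉C t₂∈ }
      ; r≢s₁ = λ { refl → ℓ∉C t₁∈ } ; r≢s₂ = λ { refl → ℓ∉C t₂∈ } ; s₁≢s₂ = t₁≢t₂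
      ; q≁z = trans (adj-p t₁∈) (e-≢ (t₁≢q ∘ sym)) ; r≁s₁ = ℓ-nbr t₁∈ ; r≁s₂ = ℓ-nbr t₂∈ }
    attach-rich big (there (here refl)) with big q∈C
    ... | t₁ , t₂ , t₁∈ , t₂∈ , t₁≢q , t₂≢q , t₁≢t₂ = record
      { z∈ = C⊆C′ q∈C ; r∈ = here refl ; s₁∈ = C⊆C′ t₁∈ ; s₂∈ = C⊆C′ t₂∈
      ; z≢q = λ { refl → ℓ∉C q∈C } ; r≢q = p≢ℓ
      ; s₁≢q = λ { refl → ℓ∉C t₁∈ } ; s₂≢q = λ { refl → ℓ∉C t₂∈ }
      ; r≢s₁ = λ { refl → p∉C t₁∈ } ; r≢s₂ = λ { refl → p∉C t₂∈ } ; s₁≢s₂ = t₁≢t₂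
      ; q≁z = ℓ-nbr q∈C ; r≁s₁ = trans (adj-p t₁∈) (e-≢ (t₁≢q ∘ sym))
      ; r≁s₂ = trans (adj-p t₂∈) (e-≢ (t₂≢q ∘ sym)) }
    attach-rich big (there (there t∈)) with big t∈
    ... | t₁ , t₂ , t₁∈ , t₂∈ , t₁≢t , t₂≢t , t₁≢t₂ = record
      { z∈ = there (here refl) ; r∈ = there (here refl) ; s₁∈ = C⊆C′ t₁∈ ; s₂∈ = C⊆C′ t₂∈
      ; z≢q = λ { refl → ℓ∉C t∈ } ; r≢q = λ { refl → ℓ∉C t∈ } ; s₁≢q = t₁≢t ; s₂≢q = t₂≢t
      ; r≢s₁ = λ { refl → ℓ∉C t₁∈ } ; r≢s₂ = λ { refl → ℓ∉C t₂∈ } ; s₁≢s₂ = t₁≢t₂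
      ; q≁z = adj-sym (ℓ-nbr t∈) ; r≁s₁ = ℓ-nbr t₁∈ ; r≁s₂ = ℓ-nbr t₂∈ }

    attach-full : ∀ {w} → Dual C q w → Rich C q → Full C → Full C′
    attach-full {w} dual rich full {u} {v} iu iv nzu nzv Qu≡Qv = join (canonical iu nzu) (canonical iv nzv)
      where
      open Reduction dual
      Target : Config n → Set
      Target v = InV C v × NZ v
      -- With coefficient 0 at `q`, the vertex `p` is lit by `e ℓ` alone. Pressing `p` and then `ℓ`
      -- leaves `v ⊕ e p`, which is `(v ⊕ w) ⊕ p̂`; `v` must differ from `w` for `reduce-p̂` to
      -- apply.
      from-ℓ : ∀ {u} → InV C u → NZ u → Reduces Target (u ⊕ e ℓ)
      from-ℓ {u} iu nz with rich-unlit rich (Q adj u) w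
      ... | v , iv , vq , Qv , nzv , nzv⊕w = reduce-via
        (reach-trans
          (reach-⊆ C⊆C′ (reach-shift (e ℓ) (λ {s} s∈ → trans (B-e adj ℓ s) (ℓ-nbr s∈))
            (full iu iv nz nzv (sym Qv))))
          (press p (here refl) lit-p (press ℓ (there (here refl)) lit-ℓ (done λ t →
            solve 4 (λ v l p w → v :+ l :+ p :+ l := v :+ w :+ (p :+ w)) refl
              (v t) (e ℓ t) (e p t) (w t)))))
        (reduce-p̂ full (rich-lit q∈C rich) Target (λ iv nz → iv , nz) (inV-⊕ iv (Dual.inV dual)) nzv⊕w)
        where
        lit-p : B adj (v ⊕ e ℓ) p ≡ true
        lit-p = trans (B-⊕ adj v (e ℓ) p)
          (cong₂ _xor_ (trans (B-p iv) vq) (trans (B-e adj ℓ p) ℓ~p))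
        lit-ℓ : B adj (v ⊕ e ℓ ⊕ e p) ℓ ≡ true
        lit-ℓ = trans (B-⊕ adj (v ⊕ e ℓ) (e p) ℓ) (cong₂ _xor_
          (trans (B-⊕ adj v (e ℓ) ℓ) (cong₂ _xor_ (B-ℓ iv) (B-self ℓ)))
          (trans (B-e adj p ℓ) p~ℓ))
      canonical : ∀ {u} → InV C′ u → NZ u → Reduces Target u
      canonical = reduce full (rich-lit q∈C rich) Target (λ iv nz → iv , nz) from-ℓ
      join : Reduces Target u → Reduces Target v → Reach C′ u v
      join (_ , ru , iu′ , nzu′) (_ , rv , iv′ , nzv′) = reach-trans ru (reach-trans
        (reach-⊆ C⊆C′ (full iu′ iv′ nzu′ nzv′ (trans (sym (reach-Q ru)) (trans Qu≡Qv (reach-Q rv)))))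
        (reach-sym rv))

  module _ {c m p ℓ : Fin n} (c~m : adj c m ≡ true) (att : Attach (c ∷ m ∷ []) c p ℓ) where
    open Attached att

    private
      m≢c : m ≢ c
      m≢c = adj⇒≢ (adj-sym c~m)
      m∈ : m ∈ c ∷ m ∷ []
      m∈ = there (here refl)

    -- Stated at the inner vertex `c`, where the next edge will turn the path m, c, p, ℓ into E₆. At
    -- an end it would fail: no vertex of the remaining three is nonadjacent to both others.
    four-rich : Rich C′ c
    four-rich = record
      { z∈ = there (here refl) ; r∈ = C⊆C′ m∈ ; s₁∈ = here refl ; s₂∈ = there (here refl)
      ; z≢q = λ { refl → ℓ∉C q∈C } ; r≢q = m≢c
      ; s₁≢q = λ { refl → p∉C q∈C } ; s₂≢q = λ { refl → ℓ∉C q∈C }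
      ; r≢s₁ = λ { refl → p∉C m∈ } ; r≢s₂ = λ { refl → ℓ∉C m∈ } ; s₁≢s₂ = p≢ℓ
      ; q≁z = adj-sym (ℓ-nbr q∈C)
      ; r≁s₁ = adj-sym (trans (adj-p m∈) (e-≢ (m≢c ∘ sym))) ; r≁s₂ = adj-sym (ℓ-nbr m∈) }

    -- The even orbit of the 4-vertex path misses V_{c,m}; it is represented by e m ⊕ e ℓ.
    four-full : Full C′
    four-full {u} {v} iu iv nzu nzv Qu≡Qv = join (canonical iu nzu) (canonical iv nzv)
      where
      open Reduction (dual-pair c~m)
      Target : Config n → Set
      Target v = (InV (c ∷ m ∷ []) v × NZ v) ⊎ v ≗ e m ⊕ e ℓ
      Q-odd : ∀ {u} → InV (c ∷ m ∷ []) u → NZ u → Q adj u ≡ true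
      Q-odd iu nz = trans (reach-Q (pair-reach c~m iu nz)) (Q-e adj m)
      Q-even : ∀ {u} → u ≗ e m ⊕ e ℓ → Q adj u ≡ false
      Q-even eq = trans (Q-cong adj eq) (trans (Q-e⊕e m ℓ) (adj-sym (ℓ-nbr m∈)))
      canonical : ∀ {u} → InV C′ u → NZ u → Reduces Target u
      canonical = reduce (pair-full c~m)
        (λ iu nz → e c , inV-e (here refl) , e-refl c , trans (Q-e adj c) (sym (Q-odd iu nz)))
        Target (λ iv nz → inj₁ (iv , nz))
        (λ iu nz → e m ⊕ e ℓ
          , reach-⊆ C⊆C′ (reach-shift (e ℓ) (λ {s} s∈ → trans (B-e adj ℓ s) (ℓ-nbr s∈)) (pair-reach c~m iu nz))
          , inj₂ λ _ → refl)
      join : Reduces Target u → Reduces Target v → Reach C′ u v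
      join (_ , ru , inj₁ (iu′ , nzu′)) (_ , rv , inj₁ (iv′ , nzv′)) = reach-trans ru (reach-trans
        (reach-⊆ C⊆C′ (pair-full c~m iu′ iv′ nzu′ nzv′ (trans (Q-odd iu′ nzu′) (sym (Q-odd iv′ nzv′)))))
        (reach-sym rv))
      join (_ , ru , inj₂ eq) (_ , rv , inj₂ eq′) = reach-trans ru
        (reach-trans (done λ t → trans (eq t) (sym (eq′ t))) (reach-sym rv))
      join (_ , ru , inj₁ (iu′ , nzu′)) (_ , rv , inj₂ eq) = ⊥-elim (false≢true
        (trans (sym (Q-even eq)) (trans (sym (reach-Q rv)) (trans (sym Qu≡Qv) (trans (reach-Q ru) (Q-odd iu′ nzu′))))))
      join (_ , ru , inj₂ eq) (_ , rv , inj₁ (iv′ , nzv′)) = ⊥-elim (false≢true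
        (trans (sym (Q-even eq)) (trans (sym (reach-Q ru)) (trans Qu≡Qv (trans (reach-Q rv) (Q-odd iv′ nzv′))))))

-- The inverse adjacency matrix and alternating paths.

module Matched {n : ℕ} (adj P : Adj n) (simple : IsSimple adj) (pm : IsPerfectMatching adj P) where
  open Forms adj simple
  open Transitivity adj simple

  P-functional : ∀ {s t t′} → P s t ≡ true → P s t′ ≡ true → t ≡ t′
  P-functional {s} st st′ with IsPerfectMatching.unique pm s
  ... | _ , _ , uniq = trans (uniq _ st) (sym (uniq _ st′))

  P-sym : ∀ {s t b} → P s t ≡ b → P t s ≡ b
  P-sym {s} {t} st = trans (IsPerfectMatching.sym pm t s) st

  P⇒adj : ∀ {s t} → P s t ≡ true → adj s t ≡ true
  P⇒adj = IsPerfectMatching.sub pm _ _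

  P-other : ∀ {s t t′} → P s t ≡ true → t′ ≢ t → P s t′ ≡ false
  P-other st t′≢t = ¬-not λ st′ → t′≢t (P-functional st′ st)

  -- A connected union of matching edges, recorded with its order of growth so that the inverse
  -- matrix can be computed along it.
  data Grow : List (Fin n) → Set where
    pair   : ∀ {a b} → P a b ≡ true → Grow (a ∷ b ∷ [])
    attach : ∀ {C q p ℓ} → Grow C → Attach C q p ℓ → P p ℓ ≡ true → Grow (p ∷ ℓ ∷ C)

  mate-closed : ∀ {C} → Grow C → ∀ {s t} → s ∈ C → P s t ≡ true → t ∈ C
  mate-closed (pair ab) (here refl) st = there (here (P-functional st ab))
  mate-closed (pair ab) (there (here refl)) st = here (P-functional st (P-sym ab))
  mate-closed (attach g att pℓ) (here refl) st = there (here (P-functional st pℓ))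
  mate-closed (attach g att pℓ) (there (here refl)) st = here (P-functional st (P-sym pℓ))
  mate-closed (attach g att pℓ) (there (there s∈)) st = there (there (mate-closed g s∈ st))

  -- The inverse adjacency matrix of the part grown so far, as a family of rows.
  W : ∀ {C} → Grow C → ∀ {s} → s ∈ C → Config n
  W (pair {a} {b} _) (here _) = e b
  W (pair {a} {b} _) (there _) = e a
  W (attach {ℓ = ℓ} g att _) (here _) = e ℓ
  W (attach {p = p} g att _) (there (here _)) = W g (Attach.q∈C att) ⊕ e p
  W (attach {q = q} {ℓ = ℓ} g att _) (there (there s∈)) = W g s∈ ⊕ W g s∈ q · e ℓ

  B-· : ∀ b u t → B adj (b · u) t ≡ b ∧ B adj u t
  B-· true u t = refl
  B-· false u t = B-𝟘 adj (λ _ → refl) t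

  -- Among the vertices of `C′`, `ℓ` is adjacent only to `p`, so adding `W g s∈ q · e ℓ` cancels the
  -- value of an old row at `p`. Adding `e p` to the row of `q` cancels its value at `q` and creates
  -- the value 1 at `ℓ`.
  W-dual : ∀ {C} (g : Grow C) {s} (s∈ : s ∈ C) → Dual C s (W g s∈)
  W-dual (pair ab) (here refl) = dual-pair (P⇒adj ab)
  W-dual (pair {a} {b} ab) (there (here refl)) = record
    { inV = inV-e (here refl)
    ; eval = λ { (here refl) → trans (B-self a) (sym (e-≢ (adj⇒≢ (P⇒adj ab) ∘ sym)))
               ; (there (here refl)) → trans (B-e adj a b) (trans (P⇒adj ab) (sym (e-refl b))) } }
  W-dual (attach {C} {q} {p} {ℓ} g att pℓ) {s} = λ
    { (here refl) → record
        { inV = inV-e (there (here refl))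
        ; eval = λ { (here refl) → trans (B-e adj ℓ p) (trans ℓ~p (sym (e-refl p)))
                   ; (there (here refl)) → trans (B-self ℓ) (sym (e-≢ p≢ℓ))
                   ; (there (there t∈)) → trans (B-e adj ℓ _)
                       (trans (ℓ-nbr t∈) (sym (e-≢ λ { refl → p∉C t∈ }))) } }
    ; (there (here refl)) → record
        { inV = inV-⊕ (inV-⊆ C⊆C′ (Dual.inV dq)) (inV-e (here refl))
        ; eval = λ { (here refl) → trans (B-⊕ adj wq (e p) p) (trans
                       (cong₂ _xor_ (trans (B-p (Dual.inV dq)) (dual-diag dq)) (B-self p))
                       (sym (e-≢ (p≢ℓ ∘ sym))))
                   ; (there (here refl)) → trans (B-⊕ adj wq (e p) ℓ) (trans
                       (cong₂ _xor_ (B-ℓ (Dual.inV dq)) (trans (B-e adj p ℓ) p~ℓ)) (sym (e-refl ℓ)))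
                   ; {t} (there (there t∈)) → trans (B-⊕ adj wq (e p) t) (trans
                       (cong₂ _xor_ (Dual.eval dq t∈) (trans (B-e adj p t) (adj-p t∈)))
                       (trans (xor-same (e q t)) (sym (e-≢ λ { refl → ℓ∉C t∈ })))) } }
    ; (there (there s∈)) →
        let w = W g s∈
            d = W-dual g s∈
        in record
        { inV = inV-⊕ (inV-⊆ C⊆C′ (Dual.inV d)) (inV-· (w q) (inV-e (there (here refl))))
        ; eval = λ { (here refl) → trans (B-⊕ adj w (w q · e ℓ) p) (trans
                       (cong₂ _xor_ (B-p (Dual.inV d))
                         (trans (B-· (w q) (e ℓ) p) (trans (cong (w q ∧_) (trans (B-e adj ℓ p) ℓ~p)) (∧-identityʳ (w q)))))
                       (trans (xor-same (w q)) (sym (e-≢ λ { refl → p∉C s∈ }))))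
                   ; (there (here refl)) → trans (B-⊕ adj w (w q · e ℓ) ℓ) (trans
                       (cong₂ _xor_ (B-ℓ (Dual.inV d))
                         (trans (B-· (w q) (e ℓ) ℓ) (trans (cong (w q ∧_) (B-self ℓ)) (∧-zeroʳ (w q)))))
                       (sym (e-≢ λ { refl → ℓ∉C s∈ })))
                   ; {t} (there (there t∈)) → trans (B-⊕ adj w (w q · e ℓ) t) (trans
                       (cong₂ _xor_ (Dual.eval d t∈)
                         (trans (B-· (w q) (e ℓ) t) (trans (cong (w q ∧_) (trans (B-e adj ℓ t) (ℓ-nbr t∈))) (∧-zeroʳ (w q)))))
                       (xor-identityʳ (e s t))) } } }
    where
    open Attached att
    wq : Config n
    wq = W g q∈C
    dq : Dual C q wq
    dq = W-dual g q∈C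

  Q-⊕·e : ∀ u b s → B adj u s ≡ false → Q adj (u ⊕ b · e s) ≡ Q adj u xor b
  Q-⊕·e u false s _ = trans (Q-cong adj λ t → xor-identityʳ (u t)) (sym (xor-identityʳ (Q adj u)))
  Q-⊕·e u true s us = trans (Q-⊕e u s) (trans (cong ((true xor Q adj u) xor_) us)
    (solve 1 (λ q → con true :+ q :+ con false := q :+ con true) refl (Q adj u)))

  module _ {C : List (Fin n)} {q p ℓ : Fin n} (g : Grow C) (att : Attach C q p ℓ) (pℓ : P p ℓ ≡ true) where
    open Attached att
    private
      g′ : Grow C′
      g′ = attach g att pℓ

    Q-W-ℓ : Q adj (W g′ (there (here refl))) ≡ Q adj (W g q∈C) xor true
    Q-W-ℓ = Q-⊕·e (W g q∈C) true p (trans (B-p (Dual.inV d)) (dual-diag d))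
      where
      d : Dual C q (W g q∈C)
      d = W-dual g q∈C

    Q-W-old : ∀ {s} (s∈ : s ∈ C) → Q adj (W g′ (C⊆C′ s∈)) ≡ Q adj (W g s∈) xor W g s∈ q
    Q-W-old s∈ = Q-⊕·e (W g s∈) (W g s∈ q) ℓ (B-ℓ (Dual.inV (W-dual g s∈)))

  ⨁-⊕·e : (u : Config n) (b : Bool) (s : Fin n) → ⨁ (u ⊕ b · e s) ≡ ⨁ u xor b
  ⨁-⊕·e u b s = trans (⨁-⊕ u (b · e s)) (cong (⨁ u xor_)
    (trans (⨁-· b (e s)) (trans (cong (b ∧_) (⨁-e₁ s)) (∧-identityʳ b))))

  -- Rows start as single vertices or arise from earlier rows by adding a multiple of a vertex
  -- orthogonal to them; that changes `Q` and the parity of the support by the same bit.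
  Q-W : ∀ {C} (g : Grow C) {s} (s∈ : s ∈ C) → Q adj (W g s∈) ≡ ⨁ (W g s∈)
  Q-W (pair {a} {b} _) (here _) = trans (Q-e adj b) (sym (⨁-e₁ b))
  Q-W (pair {a} {b} _) (there _) = trans (Q-e adj a) (sym (⨁-e₁ a))
  Q-W (attach {ℓ = ℓ} g att pℓ) (here _) = trans (Q-e adj ℓ) (sym (⨁-e₁ ℓ))
  Q-W (attach {q = q} {p = p} g att pℓ) (there (here refl)) = trans (Q-W-ℓ g att pℓ)
    (trans (cong (_xor true) (Q-W g (Attach.q∈C att))) (sym (⨁-⊕·e (W g (Attach.q∈C att)) true p)))
  Q-W (attach {q = q} {ℓ = ℓ} g att pℓ) (there (there s∈)) = trans (Q-W-old g att pℓ s∈)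
    (trans (cong (_xor W g s∈ q) (Q-W g s∈)) (sym (⨁-⊕·e (W g s∈) (W g s∈ q) ℓ)))

  W-odd : ∀ {C} (g : Grow C) → ∃ λ s → ∃ λ (s∈ : s ∈ C) → Q adj (W g s∈) ≡ true
  W-odd (pair {a} {b} _) = a , here refl , Q-e adj b
  W-odd (attach {p = p} {ℓ = ℓ} g att pℓ) = p , here refl , Q-e adj ℓ

  -- By polarisation the bit compares `Q` of the sum of the rows of `s` and `x` with `Q` of the row
  -- of `x`, since two dual vectors pair to an entry of the inverse matrix. If it is true, the sum
  -- lies in the other level set. On a single pair only `s = x` achieves this.
  W-split : ∀ {C} (g : Grow C) {x} (x∈ : x ∈ C) →
    ∃ λ s → ∃ λ (s∈ : s ∈ C) → Q adj (W g s∈) xor W g x∈ s ≡ true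

  -- `s ≢ x` keeps the sum of the two rows nonzero. At `p`, the `s` found for `q` works, because `Q`
  -- of its row changes by its entry at `q`. At `ℓ`, any row that was odd works, its change
  -- cancelling against the row of `ℓ`. At an old `x`, take `p`: its row `e ℓ` is odd and the row of
  -- `x` vanishes at `p`.
  W-split-attach : ∀ {C q p ℓ} (g : Grow C) (att : Attach C q p ℓ) (pℓ : P p ℓ ≡ true) →
    let g′ = attach g att pℓ in ∀ {x} (x∈ : x ∈ p ∷ ℓ ∷ C) →
    ∃ λ s → ∃ λ (s∈ : s ∈ p ∷ ℓ ∷ C) → s ≢ x × Q adj (W g′ s∈) xor W g′ x∈ s ≡ true
  W-split-attach {q = q} {ℓ = ℓ} g att pℓ (here refl) with W-split g (Attach.q∈C att)
  ... | s , s∈ , eq = s , C⊆C′ s∈ , (λ { refl → p∉C s∈ }) , trans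
    (cong₂ _xor_ (trans (Q-W-old g att pℓ s∈)
        (cong (Q adj (W g s∈) xor_) (dual-sym (W-dual g q∈C) (W-dual g s∈))))
      (e-≢ λ { refl → ℓ∉C s∈ }))
    (trans (xor-identityʳ _) eq)
    where open Attached att
  W-split-attach {q = q} {p = p} g att pℓ (there (here refl)) with W-odd g
  ... | s , s∈ , eq = s , C⊆C′ s∈ , (λ { refl → ℓ∉C s∈ }) , trans
    (cong₂ _xor_ (trans (Q-W-old g att pℓ s∈)
        (cong₂ _xor_ eq (dual-sym (W-dual g q∈C) (W-dual g s∈))))
      (trans (cong (W g q∈C s xor_) (e-≢ λ { refl → p∉C s∈ })) (xor-identityʳ _)))
    (solve 1 (λ a → con true :+ a :+ a := con true) refl (W g q∈C s))
    where open Attached att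
  W-split-attach {q = q} {p = p} {ℓ = ℓ} g att pℓ (there (there x∈)) =
    p , here refl , (λ { refl → p∉C x∈ }) , cong₂ _xor_ (Q-e adj ℓ)
      (cong₂ _xor_ (Dual.inV (W-dual g x∈) p∉C)
        (trans (cong (W g x∈ q ∧_) (e-≢ (p≢ℓ ∘ sym))) (∧-zeroʳ _)))
    where open Attached att

  W-split g@(pair ab) {x} x∈@(here refl) = x , x∈ , cong₂ _xor_ (Q-e adj _) (dual-diag (W-dual g x∈))
  W-split g@(pair ab) {x} x∈@(there (here refl)) = x , x∈ , cong₂ _xor_ (Q-e adj _) (dual-diag (W-dual g x∈))
  W-split (attach g att pℓ) x∈ with W-split-attach g att pℓ x∈
  ... | s , s∈ , _ , eq = s , s∈ , eq

  -- Consuming a matching edge and a non-matching edge at a time builds the alternation and both end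
  -- conditions into the shape. Distinctness of the vertices is recorded separately.
  data Alt : Fin n → Fin n → Set where
    mate : ∀ {s t} → P s t ≡ true → Alt s t
    ext  : ∀ {s u v t} → P s u ≡ true → adj u v ≡ true → P u v ≡ false → Alt v t → Alt s t

  verts : ∀ {s t} → Alt s t → List (Fin n)
  verts {s} {t} (mate _) = s ∷ t ∷ []
  verts {s} (ext {u = u} _ _ _ a) = s ∷ u ∷ verts a

  Within : ∀ {s t} → List (Fin n) → Alt s t → Set
  Within C a = ∀ {x} → x ∈ verts a → x ∈ C

  first∈ : ∀ {s t} (a : Alt s t) → s ∈ verts a
  first∈ (mate _) = here refl
  first∈ (ext _ _ _ _) = here refl

  last∈ : ∀ {s t} (a : Alt s t) → t ∈ verts a
  last∈ (mate _) = there (here refl)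
  last∈ (ext _ _ _ a) = there (there (last∈ a))

  snoc : ∀ {s q p ℓ} → Alt s q → adj q p ≡ true → P q p ≡ false → P p ℓ ≡ true → Alt s ℓ
  snoc (mate sq) qp q∤p pℓ = ext sq qp q∤p (mate pℓ)
  snoc (ext su uv u∤v a) qp q∤p pℓ = ext su uv u∤v (snoc a qp q∤p pℓ)

  verts-snoc : ∀ {s q p ℓ} (a : Alt s q) (qp : adj q p ≡ true) (q∤p : P q p ≡ false) (pℓ : P p ℓ ≡ true) →
    verts (snoc a qp q∤p pℓ) ≡ verts a ++ p ∷ ℓ ∷ []
  verts-snoc (mate _) qp q∤p pℓ = refl
  verts-snoc (ext {s} {u} _ _ _ a) qp q∤p pℓ = cong (λ l → s ∷ u ∷ l) (verts-snoc a qp q∤p pℓ)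

  -- The recursion for `W` is the recursion for paths: a path from `ℓ` stops at `p` or continues
  -- through `p` with a path from `q`, and an old path gains the end `ℓ` exactly when one reaches
  -- `q`.
  W⇒Alt : ∀ {C} (g : Grow C) {s} (s∈ : s ∈ C) {t} → W g s∈ t ≡ true →
    ∃ λ (a : Alt s t) → Within C a × Unique (verts a)
  W⇒Alt (pair {a} {b} ab) (here refl) wt with e-true {s = b} wt
  ... | refl = mate ab , (λ x∈ → x∈) , ((adj⇒≢ (P⇒adj ab)) ∷ []) ∷ [] ∷ []
  W⇒Alt (pair {a} {b} ab) (there (here refl)) wt with e-true {s = a} wt
  ... | refl = mate (P-sym ab)
    , (λ { (here eq) → there (here eq) ; (there (here eq)) → here eq })
    , ((adj⇒≢ (P⇒adj ab) ∘ sym) ∷ []) ∷ [] ∷ []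
  W⇒Alt (attach {C} {q} {p} {ℓ} g att pℓ) = λ
    { (here refl) wt → at-p (e-true {s = ℓ} wt)
    ; (there (here refl)) {t} wt → at-ℓ (W g q∈C t) refl wt
    ; (there (there s∈)) {t} wt → old s∈ (W g s∈ t) refl wt }
    where
    open Attached att
    at-p : ∀ {t} → ℓ ≡ t → ∃ λ (a : Alt p t) → Within C′ a × Unique (verts a)
    at-p refl = mate pℓ
      , (λ { (here eq) → here eq ; (there (here eq)) → there (here eq) })
      , (p≢ℓ ∷ []) ∷ [] ∷ []
    at-ℓ : ∀ {t} b → W g q∈C t ≡ b → b xor e p t ≡ true → ∃ λ (a : Alt ℓ t) → Within C′ a × Unique (verts a)
    at-ℓ false _ pt with e-true {s = p} pt
    ... | refl = mate (P-sym pℓ)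
      , (λ { (here eq) → there (here eq) ; (there (here eq)) → here eq })
      , ((p≢ℓ ∘ sym) ∷ []) ∷ [] ∷ []
    at-ℓ true wt _ with W⇒Alt g q∈C wt
    ... | a , within , uniq = ext (P-sym pℓ) p~q (P-other pℓ λ { refl → ℓ∉C q∈C }) a
      , (λ { (here eq) → there (here eq) ; (there (here eq)) → here eq
           ; (there (there x∈)) → C⊆C′ (within x∈) })
      , ((p≢ℓ ∘ sym) ∷ All.tabulate (λ { x∈ refl → ℓ∉C (within x∈) }))
        ∷ All.tabulate (λ { x∈ refl → p∉C (within x∈) }) ∷ uniq
    old : ∀ {s t} (s∈ : s ∈ C) b → W g s∈ t ≡ b → b xor (W g s∈ q ∧ e ℓ t) ≡ true →
      ∃ λ (a : Alt s t) → Within C′ a × Unique (verts a)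
    old s∈ true wt _ with W⇒Alt g s∈ wt
    ... | a , within , uniq = a , C⊆C′ ∘ within , uniq
    old {s} {t} s∈ false _ qt = new (W g s∈ q) refl qt
      where
      new : ∀ b → W g s∈ q ≡ b → b ∧ e ℓ t ≡ true → ∃ λ (a : Alt s t) → Within C′ a × Unique (verts a)
      new true wq ℓt with e-true {s = ℓ} ℓt | W⇒Alt g s∈ wq
      ... | refl | a , within , uniq = snoc a q~p q∤p pℓ , within′ , uniq′
        where
        q~p : adj q p ≡ true
        q~p = adj-sym p~q
        q∤p : P q p ≡ false
        q∤p = P-sym (P-other pℓ λ { refl → ℓ∉C q∈C })
        within′ : Within C′ (snoc a q~p q∤p pℓ)
        within′ x∈ rewrite verts-snoc a q~p q∤p pℓ with ∈-++⁻ (verts a) x∈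
        ... | inj₁ x∈a = C⊆C′ (within x∈a)
        ... | inj₂ (here eq) = here eq
        ... | inj₂ (there (here eq)) = there (here eq)
        uniq′ : Unique (verts (snoc a q~p q∤p pℓ))
        uniq′ rewrite verts-snoc a q~p q∤p pℓ = ++⁺ uniq ((p≢ℓ ∷ []) ∷ [] ∷ [])
          λ { (x∈a , here refl) → p∉C (within x∈a) ; (x∈a , there (here refl)) → ℓ∉C (within x∈a) }

  module _ {C : List (Fin n)} {q p ℓ : Fin n} (g : Grow C) (att : Attach C q p ℓ) (pℓ : P p ℓ ≡ true) where
    open Attached att

    ℓ-stuck : ∀ {v} → v ∈ C′ → adj ℓ v ≡ true → P ℓ v ≡ false → ⊥
    ℓ-stuck (here refl) _ ℓ∤v = false≢true (trans (sym ℓ∤v) (P-sym pℓ))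
    ℓ-stuck (there (here refl)) ℓv _ = adj⇒≢ ℓv refl
    ℓ-stuck (there (there v∈)) ℓv _ = false≢true (trans (sym (ℓ-nbr v∈)) ℓv)

    -- `C` is closed under mates, so the walk can leave it only along the non-matching edge from `q`
    -- to `p`. The matching edge to `ℓ` must follow, and there the walk ends by `ℓ-stuck`.
    Alt-exit : ∀ {s t} → s ∈ C → (a : Alt s t) → Within C′ a →
      Within C a ⊎ (t ≡ ℓ × ∃ λ (a′ : Alt s q) → Within C a′)
    Alt-exit s∈ (mate st) within = inj₁ λ
      { (here refl) → s∈ ; (there (here refl)) → mate-closed g s∈ st }
    Alt-exit {s} {t} s∈ (ext {u = u} {v} su uv u∤v a) within = next (within (there (there (first∈ a)))) a
      (within ∘ there ∘ there)
      where
      u∈ : u ∈ C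
      u∈ = mate-closed g s∈ su
      next : v ∈ C′ → (a : Alt v t) → Within C′ a →
        Within C (ext su uv u∤v a) ⊎ (t ≡ ℓ × ∃ λ (a′ : Alt s q) → Within C a′)
      next (here refl) (mate pt) within with p-nbr u∈ (adj-sym uv)
      ... | refl = inj₂ (P-functional pt pℓ , mate su
        , λ { (here refl) → s∈ ; (there (here refl)) → u∈ })
      next (here refl) (ext pw wz w∤z a) within with P-functional pw pℓ
      ... | refl = ⊥-elim (ℓ-stuck (within (there (there (first∈ a)))) wz w∤z)
      next (there (here refl)) _ _ = ⊥-elim (false≢true (trans (sym (ℓ-nbr u∈)) (adj-sym uv)))
      next (there (there v∈)) a within with Alt-exit v∈ a within
      ... | inj₁ w = inj₁ λ
        { (here refl) → s∈ ; (there (here refl)) → u∈ ; (there (there x∈)) → w x∈ }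
      ... | inj₂ (t≡ℓ , a′ , w) = inj₂ (t≡ℓ , ext su uv u∤v a′ , λ
        { (here refl) → s∈ ; (there (here refl)) → u∈ ; (there (there x∈)) → w x∈ })

  Alt⇒W : ∀ {C} (g : Grow C) {s} (s∈ : s ∈ C) {t} (a : Alt s t) → Within C a → W g s∈ t ≡ true
  Alt⇒W (pair {a} {b} ab) (here refl) (mate st) within with P-functional st ab
  ... | refl = e-refl b
  Alt⇒W (pair {a} {b} ab) (here refl) (ext su uv u∤v r) within
    with P-functional su ab | within (there (there (first∈ r)))
  ... | refl | here refl = ⊥-elim (false≢true (trans (sym u∤v) (P-sym ab)))
  ... | refl | there (here refl) = ⊥-elim (adj⇒≢ uv refl)
  Alt⇒W (pair {a} {b} ab) (there (here refl)) (mate st) within with P-functional st (P-sym ab)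
  ... | refl = e-refl a
  Alt⇒W (pair {a} {b} ab) (there (here refl)) (ext su uv u∤v r) within
    with P-functional su (P-sym ab) | within (there (there (first∈ r)))
  ... | refl | here refl = ⊥-elim (adj⇒≢ uv refl)
  ... | refl | there (here refl) = ⊥-elim (false≢true (trans (sym u∤v) ab))
  Alt⇒W (attach {ℓ = ℓ} g att pℓ) (here refl) (mate st) within with P-functional st pℓ
  ... | refl = e-refl ℓ
  Alt⇒W (attach g att pℓ) (here refl) (ext su uv u∤v a) within with P-functional su pℓ
  ... | refl = ⊥-elim (ℓ-stuck g att pℓ (within (there (there (first∈ a)))) uv u∤v)
  Alt⇒W (attach {p = p} g att pℓ) (there (here refl)) (mate st) within with P-functional st (P-sym pℓ)
  ... | refl = cong₂ _xor_ (Dual.inV (W-dual g (Attach.q∈C att)) (Attach.p∉C att)) (e-refl p)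
  Alt⇒W (attach {q = q} {p} {ℓ} g att pℓ) (there (here refl)) {t} (ext su uv u∤v a) within
    with P-functional su (P-sym pℓ)
  ... | refl = from (within (there (there (first∈ a)))) uv u∤v a (within ∘ there ∘ there)
    where
    open Attached att
    from : ∀ {v} → v ∈ C′ → adj p v ≡ true → P p v ≡ false → (a : Alt v t) → Within C′ a →
      W g q∈C t xor e p t ≡ true
    from (here refl) pv _ _ _ = ⊥-elim (adj⇒≢ pv refl)
    from (there (here refl)) _ p∤v _ _ = ⊥-elim (false≢true (trans (sym p∤v) pℓ))
    from (there (there v∈)) pv _ a within with p-nbr v∈ pv
    ... | refl with Alt-exit g att pℓ q∈C a within
    ...   | inj₁ w = cong₂ _xor_ (Alt⇒W g q∈C a w) (e-≢ λ { refl → p∉C (w (last∈ a)) })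
    -- An alternating walk from `q` back to `q` would put a 1 on the diagonal of the inverse matrix,
    -- which is zero because the form is alternating.
    ...   | inj₂ (_ , a′ , w) = ⊥-elim (false≢true
            (trans (sym (dual-diag (W-dual g q∈C))) (Alt⇒W g q∈C a′ w)))
  Alt⇒W (attach {q = q} {ℓ = ℓ} g att pℓ) (there (there s∈)) a within with Alt-exit g att pℓ s∈ a within
  ... | inj₁ w = cong₂ _xor_ (Alt⇒W g s∈ a w)
    (trans (cong (W g s∈ q ∧_) (e-≢ λ { refl → Attach.ℓ∉C att (w (last∈ a)) })) (∧-zeroʳ (W g s∈ q)))
  ... | inj₂ (refl , a′ , w) = cong₂ _xor_ (Dual.inV (W-dual g s∈) (Attach.ℓ∉C att))
    (cong₂ _∧_ (Alt⇒W g s∈ a′ w) (e-refl ℓ))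

  Alt-walk : ∀ {s t} (a : Alt s t) → ∃ λ (w : Walk adj s t) → vertices w ≡ verts a ×
    Alternating (inPSeq P w) × head (inPSeq P w) ≡ just true × last (inPSeq P w) ≡ just true
  Alt-walk (mate st) = step (P⇒adj st) here , refl , _ , cong just st , cong just st
  Alt-walk (ext su uv u∤v a) with Alt-walk a
  ... | here , _ , _ , () , _
  ... | w@(step vx r) , vs , alt , h , l =
    step (P⇒adj su) (step uv w) , cong (λ xs → _ ∷ _ ∷ xs) vs
    , (trans su (cong not (sym u∤v)) , trans u∤v (cong not (sym (just-injective h))) , alt)
    , cong just su , l

  walk-Alt : ∀ {s t} (w : Walk adj s t) → Alternating (inPSeq P w) →
    head (inPSeq P w) ≡ just true → last (inPSeq P w) ≡ just true → Alt s t
  walk-Alt here _ () _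
  walk-Alt (step st here) _ h _ = mate (just-injective h)
  walk-Alt {s} (step {u = u} su (step {u = v} uv here)) (eq , _) h l =
    ⊥-elim (not-¬ (trans (just-injective h) (sym (just-injective l))) eq)
  walk-Alt {s} (step {u = u} su (step {u = v} uv w@(step {u = x} vx r))) (eq , eq′ , alt) h l =
    ext su⁺ uv u∤v (walk-Alt w alt (cong just vx⁺) l)
    where
    su⁺ : P s u ≡ true
    su⁺ = just-injective h
    u∤v : P u v ≡ false
    u∤v = not-injective (trans (sym eq) su⁺)
    vx⁺ : P v x ≡ true
    vx⁺ = not-injective (trans (sym eq′) u∤v)

-- Growing vertex lists, and paths in a tree.

unique⇒length≤ : {n : ℕ} {xs : List (Fin n)} → Unique xs → length xs ≤ n
unique⇒length≤ uniq = injective⇒≤ λ {i} {j} → lookup-injective uniq i j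
  where
  lookup-injective : ∀ {n} {xs : List (Fin n)} → Unique xs → ∀ i j → lookup xs i ≡ lookup xs j → i ≡ j
  lookup-injective (x∉ ∷ _) zero zero _ = refl
  lookup-injective (x∉ ∷ _) zero (suc j) eq = ⊥-elim (All.lookup x∉ (∈-lookup j) eq)
  lookup-injective (x∉ ∷ _) (suc i) zero eq = ⊥-elim (All.lookup x∉ (∈-lookup i) (sym eq))
  lookup-injective (_ ∷ uniq) (suc i) (suc j) eq = cong suc (lookup-injective uniq i j eq)

-- Lists without repetition have at most `n` entries; `k` bounds the number of extensions still
-- possible.
saturate : {n : ℕ} {State Done : List (Fin n) → Set} → (∀ {C} → State C → Unique C) →
  (∀ {C} → State C → Done C ⊎ ∃ λ C′ → State C′ × length C < length C′) →
  ∀ {C} → State C → ∃ λ C′ → State C′ × Done C′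
saturate {n} {State} {Done} uniq next {C} st = go n st (m≤m+n n (length C))
  where
  go : ∀ k {C} → State C → n ≤ k + length C → ∃ λ C′ → State C′ × Done C′
  go k {C} st bound with next st
  go k {C} st bound | inj₁ done = C , st , done
  go zero {C} st bound | inj₂ (C′ , st′ , longer) =
    ⊥-elim (<⇒≱ (≤-<-trans bound longer) (unique⇒length≤ (uniq st′)))
  go (suc k) {C} st bound | inj₂ (C′ , st′ , longer) = go k st′ (≤-trans bound
    (subst (_≤ k + length C′) (+-suc k (length C)) (+-monoʳ-≤ k longer)))

module Paths {n : ℕ} (adj : Adj n) (tree : IsTree adj) where
  open IsTree tree
  open import Data.List.Membership.DecPropositional (_≟_ {n}) using (_∈?_)

  data Linked (C : List (Fin n)) : Fin n → Fin n → Set where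
    stop : ∀ {s} → s ∈ C → Linked C s s
    go   : ∀ {s u t} → s ∈ C → adj s u ≡ true → Linked C u t → Linked C s t

  module _ {C : List (Fin n)} where

    linked-trans : ∀ {s t u} → Linked C s t → Linked C t u → Linked C s u
    linked-trans (stop _) l = l
    linked-trans (go s∈ su l) l′ = go s∈ su (linked-trans l l′)

    linked-source : ∀ {s t} → Linked C s t → s ∈ C
    linked-source (stop s∈) = s∈
    linked-source (go s∈ _ _) = s∈

    linked-sym : ∀ {s t} → Linked C s t → Linked C t s
    linked-sym (stop s∈) = stop s∈
    linked-sym {s} (go {u = u} s∈ su l) = linked-trans (linked-sym l)
      (go (linked-source l) (trans (IsSimple.sym simple u s) su) (stop s∈))

    PathIn : Fin n → Fin n → Set
    PathIn s t = ∃ λ (w : Walk adj s t) → IsPath w × (∀ {x} → x ∈ vertices w → x ∈ C)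

    suffix : ∀ {s u t} (w : Walk adj u t) → IsPath w → (∀ {x} → x ∈ vertices w → x ∈ C) →
      s ∈ vertices w → PathIn s t
    suffix here path within (here refl) = here , path , within
    suffix w@(step _ _) path within (here refl) = w , path , within
    suffix (step _ w) (_ ∷ path) within (there s∈) = suffix w path (within ∘ there) s∈

    path-in : ∀ {s t} → Linked C s t → PathIn s t
    path-in (stop s∈) = here , [] ∷ [] , λ { (here refl) → s∈ }
    path-in {s} (go s∈ su l) with path-in l
    ... | w , path , within with s ∈? vertices w
    ...   | yes s∈w = suffix w path within s∈w
    ...   | no s∉w = step su w , All.tabulate (λ { x∈ refl → s∉w x∈ }) ∷ path
      , λ { (here refl) → s∈ ; (there x∈) → within x∈ }

    one-edge : ∀ {s t} (w : Walk adj s t) → s ≢ t → 1 ≤ length (edges w)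
    one-edge here s≢s = ⊥-elim (s≢s refl)
    one-edge (step _ _) _ = s≤s z≤n

    -- A second neighbour in a connected set would close a cycle through `u`.
    nbr-unique : ∀ {u q t} → u ∉ C → adj u q ≡ true → Linked C q t → adj u t ≡ true → t ≡ q
    nbr-unique {u} {q} {t} u∉ uq l ut with t ≟ q
    ... | yes t≡q = t≡q
    ... | no t≢q with path-in l
    ...   | w , path , within = ⊥-elim (acyclic (u , t , step uq w
      , All.tabulate (λ { x∈ refl → u∉ (within x∈) }) ∷ path
      , s≤s (one-edge w (t≢q ∘ sym)) , trans (IsSimple.sym simple t u) ut))

    -- An edge from `v` to `t` would close the cycle v, u, q, ..., t.
    no-nbr : ∀ {u v q t} → u ∉ C → v ∉ C → v ≢ u → adj v u ≡ true → adj u q ≡ true →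
      Linked C q t → adj v t ≡ false
    no-nbr {u} {v} {q} {t} u∉ v∉ v≢u vu uq l with path-in l
    ... | w , path , within = ¬-not λ vt → acyclic (v , t , step vu (step uq w)
      , (v≢u ∷ All.tabulate (λ { x∈ refl → v∉ (within x∈) }))
          ∷ All.tabulate (λ { x∈ refl → u∉ (within x∈) }) ∷ path
      , s≤s (s≤s z≤n) , trans (IsSimple.sym simple t v) vt)

    crossing : ∀ {s t} → Walk adj s t → s ∈ C → t ∉ C →
      ∃ λ q → ∃ λ u → q ∈ C × u ∉ C × adj u q ≡ true
    crossing here s∈ s∉ = ⊥-elim (s∉ s∈)
    crossing {s} (step {u = u} su w) s∈ t∉ with u ∈? C
    ... | yes u∈ = crossing w u∈ t∉
    ... | no u∉ = s , u , s∈ , u∉ , trans (IsSimple.sym simple u s) su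

    covers? : ∀ {s} → s ∈ C → (∀ t → t ∈ C) ⊎ ∃ λ q → ∃ λ u → q ∈ C × u ∉ C × adj u q ≡ true
    covers? {s} s∈ with all? (_∈? C)
    ... | yes all = inj₁ all
    ... | no ¬all with ¬∀⟶∃¬ n (_∈ C) (_∈? C) ¬all
    ...   | t , t∉ = inj₂ (crossing (connected s t) s∈ t∉)

  linked-⊆ : ∀ {C D s t} → (∀ {x} → x ∈ C → x ∈ D) → Linked C s t → Linked D s t
  linked-⊆ C⊆D (stop s∈) = stop (C⊆D s∈)
  linked-⊆ C⊆D (go s∈ su l) = go (C⊆D s∈) su (linked-⊆ C⊆D l)

-- Growing from E₆ to the whole tree.

module Covering {n : ℕ} (adj P : Adj n) (tree : IsTree adj) (pm : IsPerfectMatching adj P) where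
  open IsTree tree using (simple)
  open Forms adj simple
  open Transitivity adj simple
  open Matched adj P simple pm
  open Paths adj tree

  grow-linked : ∀ {C} → Grow C → ∀ {s t} → s ∈ C → t ∈ C → Linked C s t
  grow-linked {C} g s∈ t∈ = linked-trans (proj₂ (to-hub g) s∈) (linked-sym (proj₂ (to-hub g) t∈))
    where
    to-hub : ∀ {C} → Grow C → ∃ λ h → ∀ {s} → s ∈ C → Linked C s h
    to-hub (pair {a} {b} ab) = a , λ
      { (here refl) → stop (here refl)
      ; (there (here refl)) → go (there (here refl)) (P⇒adj (P-sym ab)) (stop (here refl)) }
    to-hub (attach {C} {q} {p} {ℓ} g att pℓ) with to-hub g
    ... | h , to-h = h , λ
      { (here refl) → from-p
      ; (there (here refl)) → go (there (here refl)) (P⇒adj (P-sym pℓ)) from-p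
      ; (there (there s∈)) → linked-⊆ (there ∘ there) (to-h s∈) }
      where
      from-p : Linked (p ∷ ℓ ∷ C) p h
      from-p = go (here refl) (Attach.p~q att) (linked-⊆ (there ∘ there) (to-h (Attach.q∈C att)))

  -- The mate of `p` lies outside `C` because `C` is closed under mates; the conditions on
  -- neighbours hold since `C` is connected and the tree has no cycle.
  attach-mate : ∀ {C q p} → Grow C → q ∈ C → p ∉ C → adj p q ≡ true →
    ∃ λ ℓ → Attach C q p ℓ × P p ℓ ≡ true
  attach-mate {C} {q} {p} g q∈ p∉ pq with IsPerfectMatching.unique pm p
  ... | ℓ , pℓ , _ = ℓ , record
    { q∈C = q∈ ; p∉C = p∉ ; ℓ∉C = ℓ∉ ; p~ℓ = P⇒adj pℓ ; p~q = pq
    ; p-nbr = λ t∈ pt → nbr-unique p∉ pq (grow-linked g q∈ t∈) pt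
    ; ℓ-nbr = λ t∈ → no-nbr p∉ ℓ∉ (adj⇒≢ (P⇒adj (P-sym pℓ))) (P⇒adj (P-sym pℓ)) pq (grow-linked g q∈ t∈) }
    , pℓ
    where
    ℓ∉ : ℓ ∉ C
    ℓ∉ ℓ∈ = p∉ (mate-closed g ℓ∈ (P-sym pℓ))

  -- The last attachment stays visible because `W-split-attach` refers to one. `Big` is carried
  -- along since richness after the next attachment is derived from it.
  data Ample : List (Fin n) → Set where
    ample : ∀ {C q p ℓ} → Grow C → Attach C q p ℓ → P p ℓ ≡ true → Full (p ∷ ℓ ∷ C) → Big (p ∷ ℓ ∷ C) →
      (∀ {t} → t ∈ p ∷ ℓ ∷ C → Rich (p ∷ ℓ ∷ C) t) → Ample (p ∷ ℓ ∷ C)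

  ample-cover : ∀ {C} → Ample C → ∃ λ C′ → Ample C′ × (∀ t → t ∈ C′)
  ample-cover = saturate uniq next
    where
    grow-unique : ∀ {C} → Grow C → Unique C
    grow-unique (pair ab) = (adj⇒≢ (P⇒adj ab) ∷ []) ∷ [] ∷ []
    grow-unique (attach g att pℓ) = (adj⇒≢ (P⇒adj pℓ) ∷ All.tabulate (λ { x∈ refl → Attach.p∉C att x∈ }))
      ∷ All.tabulate (λ { x∈ refl → Attach.ℓ∉C att x∈ }) ∷ grow-unique g
    uniq : ∀ {C} → Ample C → Unique C
    uniq (ample g att pℓ _ _ _) = grow-unique (attach g att pℓ)
    next : ∀ {C} → Ample C → (∀ t → t ∈ C) ⊎ ∃ λ C′ → Ample C′ × length C < length C′
    next (ample g att pℓ full big rich) with covers? (here refl)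
    ... | inj₁ all = inj₁ all
    ... | inj₂ (q , u , q∈ , u∉ , uq) with attach-mate (attach g att pℓ) q∈ u∉ uq
    ...   | v , att′ , uv = inj₂ (_ , ample (attach g att pℓ) att′ uv
      (attach-full att′ (W-dual (attach g att pℓ) q∈) (rich q∈) full) (attach-big att′) (attach-rich att′ big)
      , s≤s (s≤s (n≤1+n _)))

  ample-start : ∀ {c m q₁ q₂} → P c m ≡ true → adj c q₁ ≡ true → adj c q₂ ≡ true →
    q₁ ≢ m → q₂ ≢ m → q₁ ≢ q₂ → ∃ Ample
  ample-start {c} {m} {q₁} {q₂} cm cq₁ cq₂ q₁≢m q₂≢m q₁≢q₂
    with attach-mate (pair cm) (here refl)
      (λ { (here refl) → adj⇒≢ cq₁ refl ; (there (here refl)) → q₁≢m refl }) (adj-sym cq₁)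
  ... | m₁ , att₁ , q₁m₁ with attach-mate {q = c} {q₂} (attach (pair cm) att₁ q₁m₁) (there (there (here refl)))
      (λ { (here refl) → q₁≢q₂ refl
         ; (there (here refl)) → false≢true (trans (sym (Attach.ℓ-nbr att₁ (here refl))) (adj-sym cq₂))
         ; (there (there (here refl))) → adj⇒≢ cq₂ refl
         ; (there (there (there (here refl)))) → q₂≢m refl }) (adj-sym cq₂)
  ...   | m₂ , att₂ , q₂m₂ = _ , ample g₄ att₂ q₂m₂
      (attach-full att₂ (W-dual g₄ (there (there (here refl)))) (four-rich (P⇒adj cm) att₁) (four-full (P⇒adj cm) att₁))
      (attach-big att₂) (attach-rich att₂ (attach-big att₁))
    where
    g₄ : Grow (q₁ ∷ m₁ ∷ c ∷ m ∷ [])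
    g₄ = attach (pair cm) att₁ q₁m₁

  -- At most one of three neighbours is the mate of `c`; two others remain to start the long arms of
  -- E₆.
  ample-branch : ∀ {c a₁ a₂ a₃} → adj c a₁ ≡ true → adj c a₂ ≡ true → adj c a₃ ≡ true →
    a₁ ≢ a₂ → a₁ ≢ a₃ → a₂ ≢ a₃ → ∃ Ample
  ample-branch {c} {a₁} {a₂} {a₃} ca₁ ca₂ ca₃ a₁≢a₂ a₁≢a₃ a₂≢a₃ with IsPerfectMatching.unique pm c
  ... | m , cm , _ with a₁ ≟ m | a₂ ≟ m
  ...   | yes refl | _ = ample-start cm ca₂ ca₃ (a₁≢a₂ ∘ sym) (a₁≢a₃ ∘ sym) a₂≢a₃
  ...   | no a₁≢m | yes refl = ample-start cm ca₁ ca₃ a₁≢m (a₂≢a₃ ∘ sym) a₁≢a₃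
  ...   | no a₁≢m | no a₂≢m = ample-start cm ca₁ ca₂ a₁≢m a₂≢m a₁≢a₂

-- Parities and counting lights.

odd : ℕ → Bool
odd zero = false
odd (suc k) = not (odd k)

odd-+ : ∀ a b → odd (a + b) ≡ odd a xor odd b
odd-+ zero b = refl
odd-+ (suc a) b = trans (cong not (odd-+ a b)) (not-distribˡ-xor (odd a) (odd b))

odd-%1 : ∀ k → k % 2 ≡ 1 → odd k ≡ true
odd-%1 (suc zero) _ = refl
odd-%1 (suc (suc k)) eq = trans (not-involutive (odd k)) (odd-%1 k eq)

⨁-size : {n : ℕ} (w : Config n) (a : ℕ) → HasSize (λ t → w t ≡ true) a → ⨁ w ≡ odd a
⨁-size w zero (f , _ , _ , onto) = ⨁-𝟘 λ t → ¬-not λ wt → no-fin (proj₁ (onto t wt))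
  where
  no-fin : Fin 0 → ⊥
  no-fin ()
⨁-size w (suc a) (f , inj , lit , onto) = trans
  (solve 1 (λ b → b := con true :+ (b :+ con true)) refl (⨁ w))
  (cong not (trans (sym (trans (⨁-⊕ w (e (f zero))) (cong (⨁ w xor_) (⨁-e₁ (f zero)))))
    (⨁-size (w ⊕ e (f zero)) a
      ( f ∘ suc
      , (λ eq → suc-injective (inj eq))
      , (λ i → cong₂ _xor_ (lit (suc i)) (e-≢ λ eq → zero≢suc (inj eq)))
      , onto′))))
  where
  zero≢suc : ∀ {i : Fin a} → zero ≢ Fin.suc i
  zero≢suc ()
  onto′ : ∀ t → (w ⊕ e (f zero)) t ≡ true → ∃ λ i → f (suc i) ≡ t
  onto′ t eq with f zero ≟ t
  ... | yes refl rewrite lit zero = ⊥-elim (false≢true eq)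
  ... | no f₀≢t with onto t (trans (sym (xor-identityʳ (w t))) eq)
  ...   | zero , f₀≡t = ⊥-elim (f₀≢t f₀≡t)
  ...   | suc i , fᵢ≡t = i , fᵢ≡t

module _ {N : ℕ} (c : Config N) where

  private
    indicator : Fin N → ℕ
    indicator i = if c i then 1 else 0

    none-lit : ∀ xs → (∀ {t} → t ∈ xs → c t ≢ true) → sum (map indicator xs) ≡ 0
    none-lit [] _ = refl
    none-lit (x ∷ xs) off rewrite ¬-not (off (here refl)) = none-lit xs (off ∘ there)

    one-lit : ∀ {s xs} → Unique xs → (∀ {t} → t ∈ xs → c t ≡ true → t ≡ s) → sum (map indicator xs) ≤ 1
    one-lit [] _ = z≤n
    one-lit {s} {x ∷ xs} (x∉ ∷ uniq) only with c x in cx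
    ... | false = one-lit uniq (only ∘ there)
    ... | true = ≤-reflexive (cong suc (none-lit xs λ t∈ ct →
      All.lookup x∉ t∈ (trans (only (here refl) cx) (sym (only (there t∈) ct)))))

    two-lit : ∀ {s s′ xs} → Unique xs → (∀ {t} → t ∈ xs → c t ≡ true → t ≡ s ⊎ t ≡ s′) →
      sum (map indicator xs) ≤ 2
    two-lit [] _ = z≤n
    two-lit {s} {s′} {x ∷ xs} (x∉ ∷ uniq) only with c x in cx
    ... | false = two-lit uniq (only ∘ there)
    ... | true with only (here refl) cx
    ...   | inj₁ refl = s≤s (one-lit uniq λ t∈ ct → other t∈ (only (there t∈) ct))
      where
      other : ∀ {t} → t ∈ xs → t ≡ s ⊎ t ≡ s′ → t ≡ s′
      other t∈ (inj₁ eq) = ⊥-elim (All.lookup x∉ t∈ (sym eq))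
      other t∈ (inj₂ eq) = eq
    ...   | inj₂ refl = s≤s (one-lit uniq λ t∈ ct → other t∈ (only (there t∈) ct))
      where
      other : ∀ {t} → t ∈ xs → t ≡ s ⊎ t ≡ s′ → t ≡ s
      other t∈ (inj₁ eq) = eq
      other t∈ (inj₂ eq) = ⊥-elim (All.lookup x∉ t∈ (sym eq))

  numOn≤1 : ∀ s → (∀ t → c t ≡ true → t ≡ s) → numOn c ≤ 1
  numOn≤1 s only = one-lit (allFin⁺ N) λ {t} _ → only t

  numOn≤2 : ∀ s s′ → (∀ t → c t ≡ true → t ≡ s ⊎ t ≡ s′) → numOn c ≤ 2
  numOn≤2 s s′ only = two-lit (allFin⁺ N) λ {t} _ → only t

-- Sequences of moves.

module Game {N : ℕ} (G : Adj N) where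

  infix 4 _⇝_

  -- Moves end in a specific function, whereas the algebra identifies configurations only pointwise;
  -- the relation absorbs the difference.
  _⇝_ : Config N → Config N → Set
  c ⇝ d = ∃ λ d′ → Star (Move G) c d′ × d′ ≗ d

  ⇝-≗ : ∀ {c d} → c ≗ d → c ⇝ d
  ⇝-≗ {c} eq = c , ε , eq

  play : Config N → Fin N → Config N
  play c s v = c v xor G s v

  toggle-play : ∀ {c c′} → c ≗ c′ → ∀ s → toggle G c s ≗ play c′ s
  toggle-play {c} {c′} eq s v with G s v
  ... | true = trans (cong not (eq v)) (sym (xor-true (c′ v)))
    where
    xor-true : ∀ b → b xor true ≡ not b
    xor-true false = refl
    xor-true true = refl
  ... | false = trans (eq v) (sym (xor-identityʳ (c′ v)))

  star-≗ : ∀ {c c′ d} → c ≗ c′ → Star (Move G) c′ d → c ⇝ d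
  star-≗ eq ε = ⇝-≗ eq
  star-≗ {c} {c′} eq (move s lit ◅ r)
    with star-≗ (λ v → trans (toggle-play eq s v) (sym (toggle-play {c′} (λ _ → refl) s v))) r
  ... | d , r′ , eq′ = d , move s (trans (eq s) lit) ◅ r′ , eq′

  ⇝-trans : ∀ {c d f} → c ⇝ d → d ⇝ f → c ⇝ f
  ⇝-trans (d′ , r , eq) (f′ , r′ , eq′) with star-≗ eq r′
  ... | f″ , r″ , eq″ = f″ , r ◅◅ r″ , λ v → trans (eq″ v) (eq′ v)

  ⇝-play : ∀ {c} s → c s ≡ true → c ⇝ play c s
  ⇝-play {c} s lit = toggle G c s , move s lit ◅ ε , toggle-play (λ _ → refl) s

  ReducesTo : ℕ → Config N → Set
  ReducesTo k c = ∃ λ d → Star (Move G) c d × numOn d ≤ k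

  reduces-via : ∀ {k c d} → c ⇝ d → ReducesTo k d → ReducesTo k c
  reduces-via {k} {c} {d} c⇝d (f , r , on) with ⇝-trans c⇝d (f , r , λ _ → refl)
  ... | f′ , r′ , eq = f′ , r′ , subst (_≤ k)
    (cong sum (map-cong (λ i → cong (λ b → if b then 1 else 0) (sym (eq i))) (allFin N))) on

  reduces≤1 : ∀ {c} s → (∀ t → c t ≡ true → t ≡ s) → ReducesTo 1 c
  reduces≤1 {c} s only = c , ε , numOn≤1 c s only

  reduces≤2 : ∀ {c} s s′ → (∀ t → c t ≡ true → t ≡ s ⊎ t ≡ s′) → ReducesTo 2 c
  reduces≤2 {c} s s′ only = c , ε , numOn≤2 c s s′ only

-- Lifting presses to the subdivided tree.

module Subdivided {n : ℕ} (adj : Adj n) (simple : IsSimple adj) {x y : Fin n} (x~y : adj x y ≡ true) where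
  open Forms adj simple
  open Transitivity adj simple

  G : Adj (suc n)
  G = subdivide adj x y

  open Game G

  x≢y : x ≢ y
  x≢y = adj⇒≢ x~y

  nbr-z : ∀ v → e v x ∨ e v y ≡ e v x xor e v y
  nbr-z v with v ≟ x | v ≟ y
  ... | yes refl | yes refl = ⊥-elim (x≢y refl)
  ... | yes _ | no _ = refl
  ... | no _ | yes _ = refl
  ... | no _ | no _ = refl

  -- Over F₂, deleting the edge is adding its indicator; claims about moves thus become polynomial
  -- identities.
  G-old : ∀ i j → G (suc i) (suc j) ≡ adj i j xor ((e i x ∧ e j y) xor (e i y ∧ e j x))
  G-old i j with i ≟ x | i ≟ y | j ≟ x | j ≟ y
  ... | yes refl | yes refl | _ | _ = ⊥-elim (x≢y refl)
  ... | _ | _ | yes refl | yes refl = ⊥-elim (x≢y refl)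
  ... | yes refl | no _ | no _ | yes refl rewrite x~y = refl
  ... | no _ | yes refl | yes refl | no _ rewrite adj-sym x~y = refl
  ... | yes _ | no _ | yes _ | no _ = trans (∧-identityʳ (adj i j)) (sym (xor-identityʳ (adj i j)))
  ... | yes _ | no _ | no _ | no _ = trans (∧-identityʳ (adj i j)) (sym (xor-identityʳ (adj i j)))
  ... | no _ | yes _ | no _ | _ = trans (∧-identityʳ (adj i j)) (sym (xor-identityʳ (adj i j)))
  ... | no _ | no _ | _ | _ = trans (∧-identityʳ (adj i j)) (sym (xor-identityʳ (adj i j)))

  -- In terms of f ∈ V̂*, conf u c takes the value B u v on α_v for v ≠ x and on α_x + α_z, and c on α_z.
  -- Since τ_z τ_x τ_z is the transvection of α_x + α_z, every press on Γ lifts to the subdivided tree.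
  conf : Config n → Bool → Config (suc n)
  conf u c zero = c
  conf u c (suc v) = B adj u v xor (c ∧ e v x)

  conf-cong : ∀ {u v} c → (∀ t → B adj u t ≡ B adj v t) → conf u c ≗ conf v c
  conf-cong c eq zero = refl
  conf-cong c eq (suc t) = cong (_xor (c ∧ e t x)) (eq t)

  -- Pressing z keeps its state and adds δ_x + δ_y to the functional of `u`, so `u′` is specified by
  -- its values under `B`. Unlike the lifted presses, this move need not preserve `Q`.
  play-z : ∀ {u u′} → (∀ t → B adj u′ t ≡ B adj u t xor (e t x xor e t y)) → conf u true ⇝ conf u′ true
  play-z {u} {u′} eq = ⇝-trans (⇝-play zero refl) (⇝-≗ λ
    { zero → refl
    ; (suc t) → trans (cong ((B adj u t xor e t x) xor_) (nbr-z t))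
        (trans (solve 3 (λ b p q → b :+ p :+ (p :+ q) := b :+ (p :+ q) :+ p) refl (B adj u t) (e t x) (e t y))
          (cong (_xor e t x) (sym (eq t)))) })

  play-press : ∀ {u} v → B adj u v ≡ true → ∀ c →
    conf u c ⇝ conf (u ⊕ e v) (c xor (e v x xor e v y))
  play-press {u} v lit c with v ≟ x
  ... | no v≢x = ⇝-trans (⇝-play (suc v) (cong₂ _xor_ lit (trans (cong (c ∧_) vx) (∧-zeroʳ c)))) (⇝-≗ λ
    { zero → cong (c xor_) (trans (nbr-z v) (cong (_xor e v y) vx))
    ; (suc t) → trans
        (cong ((B adj u t xor (c ∧ e t x)) xor_) (trans (G-old v t)
          (cong (λ b → adj v t xor ((b ∧ e t y) xor (e v y ∧ e t x))) vx)))
        (trans (solve 5 (λ b c p a q → b :+ c :* p :+ (a :+ (con false :+ q :* p)) := b :+ a :+ (c :+ q) :* p) refl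
            (B adj u t) c (e t x) (adj v t) (e v y))
          (cong (_xor ((c xor e v y) ∧ e t x)) (sym (B-press t)))) })
    where
    vx : e v x ≡ false
    vx = e-≢ v≢x
    B-press : ∀ t → B adj (u ⊕ e v) t ≡ B adj u t xor adj v t
    B-press t = trans (B-⊕ adj u (e v) t) (cong (B adj u t xor_) (B-e adj v t))
  ... | yes refl = twice c
    where
    xx : e x x ≡ true
    xx = e-refl x
    xy : e x y ≡ false
    xy = e-≢ x≢y
    B-press : ∀ t → B adj (u ⊕ e x) t ≡ B adj u t xor adj x t
    B-press t = trans (B-⊕ adj u (e x) t) (cong (B adj u t xor_) (B-e adj x t))
    G-z : G (suc x) zero ≡ true
    G-z = trans (nbr-z x) (cong₂ _xor_ xx xy)
    G-x : ∀ t → G (suc x) (suc t) ≡ adj x t xor e t y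
    G-x t = trans (G-old x t) (trans
      (cong₂ (λ a b → adj x t xor ((a ∧ e t y) xor (b ∧ e t x))) xx xy)
      (cong (adj x t xor_) (xor-identityʳ (e t y))))
    twice : ∀ c → conf u c ⇝ conf (u ⊕ e x) (c xor (true xor e x y))
    twice c rewrite xy = order c
      where
      -- With z off, `x` is lit and its press lights z, so `x` comes first; with z on, z comes first
      -- and `x` is lit afterwards.
      order : ∀ c → conf u c ⇝ conf (u ⊕ e x) (c xor true)
      order false = ⇝-trans (⇝-play (suc x) (cong (_xor false) lit)) (⇝-trans (⇝-play zero G-z) (⇝-≗ λ
        { zero → cong (_xor false) G-z
        ; (suc t) → trans
            (cong₂ (λ a b → ((B adj u t xor false) xor a) xor b) (G-x t) (nbr-z t))
            (trans (solve 4 (λ b a p q → b :+ con false :+ (a :+ q) :+ (p :+ q) := b :+ a :+ p) refl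
                (B adj u t) (adj x t) (e t x) (e t y))
              (cong (_xor e t x) (sym (B-press t)))) }))
      order true = ⇝-trans (⇝-play zero refl) (⇝-trans (⇝-play (suc x) lit′) (⇝-≗ λ
        { zero → cong not G-z
        ; (suc t) → trans
            (cong₂ (λ a b → ((B adj u t xor e t x) xor b) xor a) (G-x t) (nbr-z t))
            (trans (solve 4 (λ b a p q → b :+ p :+ (p :+ q) :+ (a :+ q) := b :+ a :+ con false) refl
                (B adj u t) (adj x t) (e t x) (e t y))
              (cong (_xor false) (sym (B-press t)))) }))
        where
        lit′ : play (conf u true) zero (suc x) ≡ true
        lit′ = trans (cong₂ (λ a b → (B adj u x xor a) xor b) xx (trans (nbr-z x) (cong₂ _xor_ xx xy)))
          (trans (solve 1 (λ b → b :+ con true :+ con true := b) refl (B adj u x)) lit)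

  play-reach : ∀ {C u v} → Reach C u v → ∀ c → ∃ λ c′ → conf u c ⇝ conf v c′
  play-reach (done eq) c = c , ⇝-≗ (conf-cong c (B-cong adj eq))
  play-reach (press v _ lit r) c with play-reach r _
  ... | c′ , rest = c′ , ⇝-trans (play-press v lit c) rest

-- Trees with a vertex of degree at least three.

module Branching {n : ℕ} (adj P : Adj n) (tree : IsTree adj) (pm : IsPerfectMatching adj P)
  {x y : Fin n} (x~y : adj x y ≡ true) where
  open IsTree tree using (simple)
  open Forms adj simple
  open Transitivity adj simple
  open Matched adj P simple pm
  open Covering adj P tree pm
  open Subdivided adj simple x~y
  open Game G

  module Covered {D : List (Fin n)} {q p ℓ : Fin n} (g₀ : Grow D) (att : Attach D q p ℓ) (pℓ : P p ℓ ≡ true)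
    (full : Full (p ∷ ℓ ∷ D)) (covers : ∀ t → t ∈ p ∷ ℓ ∷ D) where

    g : Grow (p ∷ ℓ ∷ D)
    g = attach g₀ att pℓ

    A : Fin n → Config n
    A s = W g (covers s)

    A-dual : ∀ s → Dual (p ∷ ℓ ∷ D) s (A s)
    A-dual s = W-dual g (covers s)

    B-A : ∀ s t → B adj (A s) t ≡ e s t
    B-A s t = Dual.eval (A-dual s) (covers t)

    in-V : ∀ {u} → InV (p ∷ ℓ ∷ D) u
    in-V {t = t} t∉ = ⊥-elim (t∉ (covers t))

    nz-B : ∀ {u} t → B adj u t ≡ true → NZ u
    nz-B {u} t lit with zero? u
    ... | inj₁ nz = nz
    ... | inj₂ u≗𝟘 = ⊥-elim (false≢true (trans (sym (B-𝟘 adj u≗𝟘 t)) lit))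

    nz-A : ∀ s → NZ (A s)
    nz-A s = nz-B s (trans (B-A s s) (e-refl s))

    InA⇒A : ∀ {s t} → InA adj P s t → A s t ≡ true
    InA⇒A {s} (_ , w , _ , alt , h , l) = Alt⇒W g (covers s) (walk-Alt w alt h l) λ {v} _ → covers v

    A⇒InA : ∀ {s t} → A s t ≡ true → InA adj P s t
    A⇒InA {s} {t} st with W⇒Alt g (covers s) st
    ... | a , _ , uniq with Alt-walk a
    ...   | w , vs , alt , h , l = (λ { refl → false≢true (trans (sym (dual-diag (A-dual s))) st) })
      , w , subst Unique (sym vs) uniq , alt , h , l

    Q-A : ∀ s {a} → HasSize (InA adj P s) a → Q adj (A s) ≡ odd a
    Q-A s {a} (f , inj , lit , onto) = trans (Q-W g (covers s))
      (⨁-size (A s) a (f , inj , (λ i → InA⇒A (lit i)) , λ t st → onto t (A⇒InA st)))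

    -- The rows `A s` are preimages of the basis functionals. This is the nondegeneracy that writes
    -- every configuration of the subdivided tree as some `conf u c`.
    B-onto : ∀ h → ∃ λ u → ∀ t → B adj u t ≡ h t
    B-onto = ⊕-induction (λ h → ∃ λ u → ∀ t → B adj u t ≡ h t)
      (λ eq (u , Bu) → u , λ t → trans (Bu t) (eq t))
      (𝟘 , B-𝟘 adj (λ _ → refl))
      (λ (u , Bu) (v , Bv) → u ⊕ v , λ t → trans (B-⊕ adj u v t) (cong₂ _xor_ (Bu t) (Bv t)))
      (λ s → A s , B-A s)

    as-conf : ∀ f → ∃ λ u → f ≗ conf u (f zero)
    as-conf f with B-onto (λ t → f (suc t) xor (f zero ∧ e t x))
    ... | u , Bu = u , λ
      { zero → refl
      ; (suc t) → sym (trans (cong (_xor (f zero ∧ e t x)) (Bu t))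
          (solve 2 (λ a b → a :+ b :+ b := a) refl (f (suc t)) (f zero ∧ e t x))) }

    -- The lifted sequence of presses leaves the final state of z uncontrolled, so `final` must
    -- cover both states.
    to-orbit : ∀ {k u v} → NZ u → NZ v → Q adj u ≡ Q adj v → (∀ c → ReducesTo k (conf v c)) →
      ∀ c → ReducesTo k (conf u c)
    to-orbit {u = u} {v} nzu nzv Qu≡Qv final c with play-reach (full (in-V {u}) (in-V {v}) nzu nzv Qu≡Qv) c
    ... | c′ , r = reduces-via r (final c′)

    -- With z off the only light is at `x`; with z on the two contributions at `x` cancel and the
    -- only light is z.
    A-x-1lit : ∀ c → ReducesTo 1 (conf (A x) c)
    A-x-1lit false = reduces≤1 (suc x) λ
      { zero ()
      ; (suc t) lit → cong suc (sym (e-true (trans (sym (B-A x t)) (trans (sym (xor-identityʳ _)) lit)))) }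
    A-x-1lit true = reduces≤1 zero λ
      { zero _ → refl
      ; (suc t) lit → ⊥-elim (false≢true (trans
          (sym (trans (cong₂ _xor_ (B-A x t) (e-sym t x)) (xor-same (e x t)))) lit)) }

    A-y-1lit : ∀ c → ReducesTo 1 (conf (A y) c)
    A-y-1lit false = reduces≤1 (suc y) λ
      { zero ()
      ; (suc t) lit → cong suc (sym (e-true (trans (sym (B-A y t)) (trans (sym (xor-identityʳ _)) lit)))) }
    -- Here `x`, `y` and z are all lit, and pressing z switches off the other two.
    A-y-1lit true = reduces-via (play-z λ t → trans (B-A x t) (trans
        (trans (e-sym x t) (solve 2 (λ a b → a := b :+ (a :+ b)) refl (e t x) (e t y)))
        (cong (_xor (e t x xor e t y)) (sym (trans (B-A y t) (e-sym y t))))))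
      (A-x-1lit true)

    -- As c varies, w ⊕ A x gives δ_s + δ_x or δ_s + δ_z.
    pair-2lit : ∀ {s w} → (∀ t → B adj w t ≡ e s t) → ∀ c → ReducesTo 2 (conf (w ⊕ A x) c)
    pair-2lit {s} {w} B-w c = reduces≤2 (suc s) (if c then zero else suc x) (only c)
      where
      only : ∀ c t → conf (w ⊕ A x) c t ≡ true → t ≡ suc s ⊎ t ≡ (if c then zero else suc x)
      only true zero _ = inj₂ refl
      only c (suc t) lit with s ≟ t
      ... | yes refl = inj₁ refl
      ... | no s≢t = inj₂ (at-x c (trans (sym (cong (_xor (c ∧ e t x))
              (trans (B-⊕ adj w (A x) t) (cong₂ _xor_ (trans (B-w t) (e-≢ s≢t)) (B-A x t))))) lit))
        where
        at-x : ∀ c → e x t xor (c ∧ e t x) ≡ true → suc t ≡ (if c then zero else suc x)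
        at-x false eq = cong suc (sym (e-true (trans (sym (xor-identityʳ _)) eq)))
        at-x true eq = ⊥-elim (false≢true (trans
          (sym (trans (cong (e x t xor_) (e-sym t x)) (xor-same (e x t)))) eq))

    klit-from-nonzero : ∀ {k} → 1 ≤ k → (∀ {u} → NZ u → ∀ c → ReducesTo k (conf u c)) → KLit G k
    klit-from-nonzero {k} 1≤k nonzero f with as-conf f
    ... | u , f≗ = reduces-via (⇝-≗ f≗) (from u (f zero))
      where
      from : ∀ u c → ReducesTo k (conf u c)
      from u c with zero? u
      ... | inj₁ nz = nonzero nz c
      from u false | inj₂ u≗𝟘 = conf u false , ε , ≤-trans (numOn≤1 (conf u false) zero λ
        { zero ()
        ; (suc t) lit → ⊥-elim (false≢true (trans
            (sym (trans (xor-identityʳ _) (B-𝟘 adj u≗𝟘 t))) lit)) }) 1≤k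
      -- For `u` zero the lights are z and `x`. Pressing z moves the light at `x` to `y`, and the
      -- new configuration has the nonzero vector `A x ⊕ A y`.
      from u true | inj₂ u≗𝟘 = reduces-via (play-z {u = u} {u′ = A x ⊕ A y} λ t →
          trans (B-A-xy t) (cong (_xor (e t x xor e t y)) (sym (B-𝟘 adj u≗𝟘 t))))
        (nonzero (nz-B x (trans (B-A-xy x) (cong₂ _xor_ (e-refl x) (e-≢ x≢y)))) true)
        where
        B-A-xy : ∀ t → B adj (A x ⊕ A y) t ≡ e t x xor e t y
        B-A-xy t = trans (B-⊕ adj (A x) (A y) t)
          (cong₂ _xor_ (trans (B-A x t) (e-sym x t)) (trans (B-A y t) (e-sym y t)))

    odd-1lit : OddType adj P x y → KLit G 1
    odd-1lit (a , b , size-x , size-y , eq) = klit-from-nonzero (s≤s z≤n) λ {u} nz → by-Q nz (Q adj u ≟ᵇ Q adj (A x))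
      where
      differ : Q adj (A x) xor Q adj (A y) ≡ true
      differ = trans (cong₂ _xor_ (Q-A x size-x) (Q-A y size-y)) (trans (sym (odd-+ a b)) (odd-%1 (a + b) eq))
      by-Q : ∀ {u} → NZ u → Dec (Q adj u ≡ Q adj (A x)) → ∀ c → ReducesTo 1 (conf u c)
      by-Q nz (yes Q≡) = to-orbit nz (nz-A x) Q≡ A-x-1lit
      by-Q nz (no Q≢) = to-orbit nz (nz-A y) (trans (¬-not Q≢) (flip (Q adj (A x)) (Q adj (A y)) differ)) A-y-1lit
        where
        flip : ∀ a b → a xor b ≡ true → not a ≡ b
        flip false b eq = sym eq
        flip true false _ = refl

    even-2lit : EvenType adj P x y → KLit G 2
    even-2lit _ = klit-from-nonzero (s≤s z≤n) λ {u} nz → by-Q nz (Q adj u ≟ᵇ Q adj (A x))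
      where
      by-Q : ∀ {u} → NZ u → Dec (Q adj u ≡ Q adj (A x)) → ∀ c → ReducesTo 2 (conf u c)
      by-Q nz (yes Q≡) = to-orbit nz (nz-A x) Q≡ λ c → relax (A-x-1lit c)
        where
        relax : ∀ {f} → ReducesTo 1 f → ReducesTo 2 f
        relax (d , r , on) = d , r , ≤-trans on (s≤s z≤n)
      by-Q nz (no Q≢) with W-split-attach g₀ att pℓ (covers x)
      ... | s , s∈ , s≢x , split = to-orbit nz
        (nz-B s (trans (B-⊕ adj w (A x) s) (cong₂ _xor_ (trans (B-w s) (e-refl s))
          (trans (B-A x s) (e-≢ (s≢x ∘ sym))))))
        (trans (¬-not Q≢) (sym Q-pair))
        (pair-2lit B-w)
        where
        w : Config n
        w = W g s∈
        B-w : ∀ t → B adj w t ≡ e s t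
        B-w t = Dual.eval (W-dual g s∈) (covers t)
        Q-pair : Q adj (w ⊕ A x) ≡ not (Q adj (A x))
        Q-pair = trans (Q-⊕ simple w (A x)) (trans
          (cong ((Q adj w xor Q adj (A x)) xor_) (dual-BB (W-dual g s∈) (in-V {A x})))
          (trans (solve 3 (λ a b c → (a :+ b) :+ c := (a :+ c) :+ b) refl (Q adj w) (Q adj (A x)) (A x s))
            (cong (_xor Q adj (A x)) split)))

-- The game on an induced path.

data Chain {N : ℕ} (G : Adj N) : List (Fin N) → Set where
  single : ∀ {v} → Chain G (v ∷ [])
  cons   : ∀ {v w L} → G v w ≡ true → (∀ {t} → t ∈ L → G v t ≡ false) → v ∉ w ∷ L →
    Chain G (w ∷ L) → Chain G (v ∷ w ∷ L)

chain-unique : ∀ {N} {G : Adj N} {C} → Chain G C → Unique C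
chain-unique single = [] ∷ []
chain-unique (cons _ _ v∉ ch) = All.tabulate (λ { t∈ refl → v∉ t∈ }) ∷ chain-unique ch

module ChainGame {N : ℕ} (G : Adj N) (simple : IsSimple G) where
  open Game G

  data OneLit (f : Config N) : List (Fin N) → Set where
    lit-here  : ∀ {v L} → f v ≡ true → (∀ {t} → t ∈ L → f t ≡ false) → OneLit f (v ∷ L)
    lit-there : ∀ {v L} → f v ≡ false → OneLit f L → OneLit f (v ∷ L)

  oneLit-cong : ∀ {f f′ L} → (∀ {t} → t ∈ L → f′ t ≡ f t) → OneLit f L → OneLit f′ L
  oneLit-cong eq (lit-here lit off) = lit-here (trans (eq (here refl)) lit) λ t∈ → trans (eq (there t∈)) (off t∈)
  oneLit-cong eq (lit-there off one) = lit-there (trans (eq (here refl)) off) (oneLit-cong (eq ∘ there) one)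

  lit-position : ∀ {f L} → OneLit f L → ∃ λ s → ∀ {t} → t ∈ L → f t ≡ true → t ≡ s
  lit-position (lit-here {v} _ off) = v , λ
    { (here refl) _ → refl ; (there t∈) lit → ⊥-elim (false≢true (trans (sym (off t∈)) lit)) }
  lit-position (lit-there off one) with lit-position one
  ... | s , only = s , λ
    { (here refl) lit → ⊥-elim (false≢true (trans (sym off) lit)) ; (there t∈) lit → only t∈ lit }

  -- Playing the vertices of the path in turn, up to the one before the lit vertex, merges two lights into one.
  slide : ∀ {v L f} → Chain G (v ∷ L) → f v ≡ true → OneLit f L →
    ∃ λ f′ → f ⇝ f′ × OneLit f′ (v ∷ L) × (∀ t → (∀ {s} → s ∈ L → G s t ≡ false) → f′ t ≡ f t xor G v t)
  slide {v} {f = f} (cons {w = w} vw v≁ v∉ ch) fv (lit-here fw off) = play f v , ⇝-play v fv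
    , lit-here (cong₂ _xor_ fv (IsSimple.irrefl simple v)) (λ
        { (here refl) → cong₂ _xor_ fw vw ; (there t∈) → cong₂ _xor_ (off t∈) (v≁ t∈) })
    , λ _ _ → refl
  slide {v} {f = f} (cons {w = w} vw v≁ v∉ ch) fv (lit-there fw one)
    with slide {f = play f v} ch (cong₂ _xor_ fw vw)
           (oneLit-cong (λ {t} t∈ → trans (cong (f t xor_) (v≁ t∈)) (xor-identityʳ (f t))) one)
  ... | f′ , r , one′ , outside = f′ , ⇝-trans (⇝-play v fv) r
    , lit-there (trans (outside v λ {s} s∈ → trans (IsSimple.sym simple s v) (v≁ s∈))
        (cong₂ _xor_ (cong₂ _xor_ fv (IsSimple.irrefl simple v)) (trans (IsSimple.sym simple w v) vw))) one′
    , λ t t≁ → trans (outside t (t≁ ∘ there)) (trans (cong (play f v t xor_) (t≁ (here refl))) (xor-identityʳ _))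

  -- The tail is reduced to at most one light before the head is inspected, because moves in the
  -- tail may toggle the head; a lit head is then merged by `slide`.
  chain-reduce : ∀ {C} → Chain G C → ∀ f →
    ∃ λ f′ → f ⇝ f′ × ((∀ {t} → t ∈ C → f′ t ≡ false) ⊎ OneLit f′ C)
  chain-reduce (single {v}) f = f , ⇝-≗ (λ _ → refl) , at (f v) refl
    where
    at : ∀ b → f v ≡ b → (∀ {t} → t ∈ v ∷ [] → f t ≡ false) ⊎ OneLit f (v ∷ [])
    at false fv = inj₁ λ { (here refl) → fv }
    at true fv = inj₂ (lit-here fv λ ())
  chain-reduce (cons {v} {w} {L} vw v≁ v∉ ch) f with chain-reduce ch f
  ... | f′ , r , rest = at (f′ v) refl rest
    where
    at : ∀ b → f′ v ≡ b → (∀ {t} → t ∈ w ∷ L → f′ t ≡ false) ⊎ OneLit f′ (w ∷ L) →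
      ∃ λ f″ → f ⇝ f″ × ((∀ {t} → t ∈ v ∷ w ∷ L → f″ t ≡ false) ⊎ OneLit f″ (v ∷ w ∷ L))
    at false fv (inj₁ off) = f′ , r , inj₁ λ { (here refl) → fv ; (there t∈) → off t∈ }
    at false fv (inj₂ one) = f′ , r , inj₂ (lit-there fv one)
    at true fv (inj₁ off) = f′ , r , inj₂ (lit-here fv off)
    at true fv (inj₂ one) with slide (cons vw v≁ v∉ ch) fv one
    ... | f″ , r′ , one′ , _ = f″ , ⇝-trans r r′ , inj₂ one′

  chain-1lit : ∀ {C} → Chain G C → (∀ t → t ∈ C) → KLit G 1
  chain-1lit ch covers f with chain-reduce ch f
  ... | f′ , r , inj₂ one with lit-position one
  ...   | s , only = reduces-via r (reduces≤1 s λ t → only (covers t))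
  chain-1lit {C} ch covers f | f′ , r , inj₁ off = reduces-via r (reduces≤1 (first ch)
    λ t lit → ⊥-elim (false≢true (trans (sym (off (covers t))) lit)))
    where
    first : ∀ {C} → Chain G C → Fin N
    first (single {v}) = v
    first (cons {v} _ _ _ _) = v

-- A tree with all degrees at most two is a path.

module Thin {n : ℕ} (adj : Adj n) (tree : IsTree adj)
  (thin : ∀ {v a b c} → adj v a ≡ true → adj v b ≡ true → adj v c ≡ true → a ≢ b → c ≡ a ⊎ c ≡ b) where
  open IsTree tree using (simple)
  open Transitivity adj simple using (adj⇒≢; adj-sym)
  open Paths adj tree
  open import Data.List.Membership.DecPropositional (_≟_ {n}) using (_∈?_)

  data Long : List (Fin n) → Set where
    long : ∀ {h w L} → Chain adj (h ∷ w ∷ L) → Long (h ∷ w ∷ L)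

  -- A chain grown from a leaf: all its vertices but the head have their neighbours inside, so once
  -- the head does too, connectedness makes it the whole tree.
  data Settled : List (Fin n) → Set where
    settled : ∀ {h w L} → Chain adj (h ∷ w ∷ L) →
      (∀ {t u} → t ∈ w ∷ L → adj t u ≡ true → u ∈ h ∷ w ∷ L) → Settled (h ∷ w ∷ L)

  HeadClosed : List (Fin n) → Set
  HeadClosed [] = ⊤
  HeadClosed (h ∷ L) = ∀ u → adj h u ≡ true → u ∈ h ∷ L

  chain-linked : ∀ {h L t} → Chain adj (h ∷ L) → t ∈ h ∷ L → Linked (h ∷ L) h t
  chain-linked _ (here refl) = stop (here refl)
  chain-linked (cons vw _ _ ch) (there t∈) = go (here refl) vw (linked-⊆ there (chain-linked ch t∈))

  extend : ∀ {h L} → Chain adj (h ∷ L) →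
    HeadClosed (h ∷ L) ⊎ ∃ λ u → adj h u ≡ true × Chain adj (u ∷ h ∷ L)
  extend {h} {L} ch with any? (λ u → (adj h u ≟ᵇ true) ×-dec ¬? (u ∈? (h ∷ L)))
  ... | yes (u , hu , u∉) = inj₂ (u , hu , cons (adj-sym hu) (λ t∈ → ¬-not λ ut →
          head∉ ch (subst (_∈ L) (nbr-unique u∉ (adj-sym hu) (chain-linked ch (there t∈)) ut) t∈)) u∉ ch)
    where
    head∉ : ∀ {h L} → Chain adj (h ∷ L) → h ∉ L
    head∉ single ()
    head∉ (cons _ _ h∉ _) = h∉
  ... | no none = inj₁ λ u hu → decidable-stable (u ∈? (h ∷ L)) λ u∉ → none (u , hu , u∉)

  thin-chain : ∀ {x y} → adj x y ≡ true → ∃ λ C → Chain adj C × (∀ t → t ∈ C)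
  thin-chain {x} {y} xy with saturate uniq next (long (cons xy (λ ()) (λ { (here refl) → adj⇒≢ xy refl ; (there ()) }) single))
    where
    uniq : ∀ {C} → Long C → Unique C
    uniq (long ch) = chain-unique ch
    next : ∀ {C} → Long C → HeadClosed C ⊎ ∃ λ C′ → Long C′ × length C < length C′
    next (long ch) with extend ch
    ... | inj₁ closed = inj₁ closed
    ... | inj₂ (u , _ , ch′) = inj₂ (_ , long ch′ , ≤-refl)
  -- The head of a maximal chain is a leaf, since its only neighbour in the chain is `w`; growth
  -- restarts from that leaf in the other direction.
  ... | _ , long {h} {w} {L} (cons hw h≁ h∉ _) , closed = from-leaf
    (saturate uniq next (settled
      (cons (adj-sym hw) (λ ()) (λ { (here refl) → h∉ (here refl) ; (there ()) }) (single {v = h}))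
      λ { (here refl) hu → here (leaf hu (closed _ hu)) }))
    where
    leaf : ∀ {u} → adj h u ≡ true → u ∈ h ∷ w ∷ L → u ≡ w
    leaf hu (here refl) = ⊥-elim (adj⇒≢ hu refl)
    leaf hu (there (here eq)) = eq
    leaf hu (there (there u∈)) = ⊥-elim (false≢true (trans (sym (h≁ u∈)) hu))
    uniq : ∀ {C} → Settled C → Unique C
    uniq (settled ch _) = chain-unique ch
    next : ∀ {C} → Settled C → HeadClosed C ⊎ ∃ λ C′ → Settled C′ × length C < length C′
    next (settled {h} {w} ch@(cons hw _ _ _) nbrs) with extend ch
    ... | inj₁ closed = inj₁ closed
    ... | inj₂ (u , hu , ch′@(cons _ _ u∉ _)) = inj₂ (_ , settled ch′ nbrs′ , ≤-refl)
      where
      nbrs′ : ∀ {t v} → t ∈ h ∷ _ → adj t v ≡ true → v ∈ u ∷ h ∷ _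
      nbrs′ (here refl) hv with thin hu hw hv (λ { refl → u∉ (there (here refl)) })
      ... | inj₁ refl = here refl
      ... | inj₂ refl = there (there (here refl))
      nbrs′ (there t∈) tv = there (nbrs t∈ tv)
    from-leaf : (∃ λ C → Settled C × HeadClosed C) → ∃ λ C → Chain adj C × (∀ t → t ∈ C)
    from-leaf (C , settled ch nbrs , closed) with covers? (here refl)
    ... | inj₁ all = C , ch , all
    ... | inj₂ (q , u , here refl , u∉ , uq) = ⊥-elim (u∉ (closed u (adj-sym uq)))
    ... | inj₂ (q , u , there q∈ , u∉ , uq) = ⊥-elim (u∉ (nbrs q∈ (adj-sym uq)))

-- Inserting the new vertex into the path.

module Insertion {n : ℕ} (adj : Adj n) (simple : IsSimple adj) {x y : Fin n} (x~y : adj x y ≡ true) where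
  open Transitivity adj simple using (adj⇒≢; adj-sym)
  open Subdivided adj simple x~y

  G-simple : IsSimple G
  G-simple = record
    { sym = λ { zero zero → refl ; zero (suc j) → refl ; (suc i) zero → refl ; (suc i) (suc j) → G-sym i j }
    ; irrefl = λ { zero → refl ; (suc i) → cong (_∧ _) (IsSimple.irrefl simple i) } }
    where
    G-sym : ∀ i j → G (suc i) (suc j) ≡ G (suc j) (suc i)
    G-sym i j = trans (G-old i j) (trans
      (cong₂ _xor_ (IsSimple.sym simple i j)
        (solve 4 (λ a b c d → a :* b :+ c :* d := d :* c :+ b :* a) refl (e i x) (e j y) (e i y) (e j x)))
      (sym (G-old j i)))

  G-non-edge : ∀ {i j} → adj i j ≡ false → G (suc i) (suc j) ≡ false
  G-non-edge eq = cong (_∧ _) eq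

  G-edge : ∀ {i j} → adj i j ≡ true → ¬ (i ≡ x × j ≡ y) → ¬ (i ≡ y × j ≡ x) → G (suc i) (suc j) ≡ true
  G-edge {i} {j} ij ¬xy ¬yx = trans (G-old i j) (trans
    (cong₂ (λ a b → a xor b) ij (cong₂ _xor_ (both ¬xy) (both ¬yx))) refl)
    where
    both : ∀ {i j a b : Fin n} → ¬ (i ≡ a × j ≡ b) → e i a ∧ e j b ≡ false
    both {i} {j} {a} {b} ¬eq with i ≟ a | j ≟ b
    ... | yes refl | yes refl = ⊥-elim (¬eq (refl , refl))
    ... | yes _ | no _ = refl
    ... | no _ | _ = refl

  xy-removed : G (suc x) (suc y) ≡ false
  xy-removed = trans (G-old x y) (trans
    (cong₂ _xor_ x~y (cong₂ _xor_ (cong₂ _∧_ (e-refl x) (e-refl y)) (cong (_∧ e y x) (e-≢ x≢y)))) refl)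

  G-z-x : G zero (suc x) ≡ true
  G-z-x = trans (nbr-z x) (cong₂ _xor_ (e-refl x) (e-≢ x≢y))

  G-z-y : G zero (suc y) ≡ true
  G-z-y = trans (nbr-z y) (cong₂ _xor_ (e-≢ (x≢y ∘ sym)) (e-refl y))

  G-z-other : ∀ {v} → v ≢ x → v ≢ y → G zero (suc v) ≡ false
  G-z-other {v} v≢x v≢y = trans (nbr-z v) (cong₂ _xor_ (e-≢ v≢x) (e-≢ v≢y))

  suc-∈ : ∀ {t : Fin n} {L} → suc t ∈ map suc L → t ∈ L
  suc-∈ {L = L} t∈ with ∈-map⁻ suc t∈
  ... | _ , t∈L , refl = t∈L

  chain-lift : ∀ {C} → ¬ (x ∈ C × y ∈ C) → Chain adj C → Chain G (map suc C)
  chain-lift ¬both single = single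
  chain-lift {v ∷ w ∷ L} ¬both (cons vw v≁ v∉ ch) = cons
    (G-edge vw (λ { (refl , refl) → ¬both (here refl , there (here refl)) })
               (λ { (refl , refl) → ¬both (there (here refl) , here refl) }))
    (λ t∈ → non-adj (∈-map⁻ suc t∈))
    (v∉ ∘ suc-∈)
    (chain-lift (λ (x∈ , y∈) → ¬both (there x∈ , there y∈)) ch)
    where
    non-adj : ∀ {t} → (∃ λ s → s ∈ L × t ≡ suc s) → G (suc v) t ≡ false
    non-adj (s , s∈ , refl) = G-non-edge (v≁ s∈)

  -- The head is kept as `suc v` so that further vertices can be put in front; `rest⊆` yields that
  -- they are new and adjacent to nothing behind the head.
  record Inserted (v : Fin n) (L : List (Fin n)) : Set where
    field
      rest     : List (Fin (suc n))
      chain    : Chain G (suc v ∷ rest)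
      z∈rest   : zero ∈ rest
      rest⊆    : ∀ {r} → r ∈ rest → r ≡ zero ⊎ ∃ λ t → t ∈ L × r ≡ suc t
      ⊆rest    : ∀ {t} → t ∈ L → suc t ∈ rest

  insert-here : ∀ {v w L} → G (suc v) zero ≡ true → G (suc v) (suc w) ≡ false → G zero (suc w) ≡ true →
    (∀ {t} → t ∈ L → G zero (suc t) ≡ false) → ¬ (x ∈ w ∷ L × y ∈ w ∷ L) →
    Chain adj (v ∷ w ∷ L) → Inserted v (w ∷ L)
  insert-here {v} {w} {L} vz v≁w zw z≁ ¬both (cons vw v≁ v∉ ch) = record
    { rest = zero ∷ map suc (w ∷ L)
    ; chain = cons vz (λ t∈ → v-non-adj (∈-map⁻ suc t∈))
        (λ { (there v∈) → v∉ (suc-∈ v∈) })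
        (cons zw (λ t∈ → z-non-adj (∈-map⁻ suc t∈)) (λ z∈ → z∉ (∈-map⁻ suc z∈)) (chain-lift ¬both ch))
    ; z∈rest = here refl
    ; rest⊆ = λ { (here refl) → inj₁ refl ; (there r∈) → inj₂ (∈-map⁻ suc r∈) }
    ; ⊆rest = λ t∈ → there (∈-map⁺ suc t∈) }
    where
    v-non-adj : ∀ {t} → (∃ λ s → s ∈ w ∷ L × t ≡ suc s) → G (suc v) t ≡ false
    v-non-adj (_ , here refl , refl) = v≁w
    v-non-adj (_ , there s∈ , refl) = G-non-edge (v≁ s∈)
    z-non-adj : ∀ {t} → (∃ λ s → s ∈ L × t ≡ suc s) → G zero t ≡ false
    z-non-adj (_ , s∈ , refl) = z≁ s∈
    z∉ : (∃ λ s → s ∈ w ∷ L × zero ≡ Fin.suc s) → ⊥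
    z∉ (_ , _ , ())

  -- In an induced path the adjacent vertices `x` and `y` are consecutive, in one of two orders, and
  -- z goes between them.
  insert : ∀ {v L} → Chain adj (v ∷ L) → x ∈ v ∷ L → y ∈ v ∷ L → Inserted v L
  insert _ (here refl) (here refl) = ⊥-elim (x≢y refl)
  insert ch@(cons _ _ x∉ (cons _ _ y∉ _)) (here refl) (there (here refl)) =
    insert-here G-z-x xy-removed G-z-y
      (λ {t} t∈ → G-z-other {t} (λ { refl → x∉ (there t∈) }) λ { refl → y∉ t∈ }) (x∉ ∘ proj₁) ch
  insert ch@(cons _ _ x∉ single) (here refl) (there (here refl)) =
    insert-here G-z-x xy-removed G-z-y (λ ()) (x∉ ∘ proj₁) ch
  insert (cons _ x≁ _ _) (here refl) (there (there y∈)) = ⊥-elim (false≢true (trans (sym (x≁ y∈)) x~y))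
  insert ch@(cons _ _ y∉ (cons _ _ x∉ _)) (there (here refl)) (here refl) =
    insert-here G-z-y (trans (IsSimple.sym G-simple (suc y) (suc x)) xy-removed) G-z-x
      (λ {t} t∈ → G-z-other {t} (λ { refl → x∉ t∈ }) λ { refl → y∉ (there t∈) }) (y∉ ∘ proj₂) ch
  insert ch@(cons _ _ y∉ single) (there (here refl)) (here refl) =
    insert-here G-z-y (trans (IsSimple.sym G-simple (suc y) (suc x)) xy-removed) G-z-x (λ ()) (y∉ ∘ proj₂) ch
  insert (cons _ y≁ _ _) (there (there x∈)) (here refl) =
    ⊥-elim (false≢true (trans (sym (y≁ x∈)) (adj-sym x~y)))
  insert {v} (cons {w = w} {L} vw v≁ v∉ ch) (there x∈) (there y∈) = record
    { rest = suc w ∷ rest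
    ; chain = cons
        (G-edge vw (λ { (refl , _) → v∉ x∈ }) (λ { (refl , _) → v∉ y∈ }))
        (λ r∈ → non-adj (rest⊆ r∈))
        (λ { (here refl) → v∉ (here refl) ; (there v∈) → not-in-rest (rest⊆ v∈) })
        chain
    ; z∈rest = there z∈rest
    ; rest⊆ = λ { (here refl) → inj₂ (w , here refl , refl) ; (there r∈) → later (rest⊆ r∈) }
    ; ⊆rest = λ { (here refl) → here refl ; (there t∈) → there (⊆rest t∈) } }
    where
    open Inserted (insert ch x∈ y∈)
    non-adj : ∀ {r} → r ≡ zero ⊎ (∃ λ t → t ∈ L × r ≡ suc t) → G (suc v) r ≡ false
    non-adj (inj₁ refl) = G-z-other {v} (λ { refl → v∉ x∈ }) λ { refl → v∉ y∈ }
    non-adj (inj₂ (_ , t∈ , refl)) = G-non-edge (v≁ t∈)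
    not-in-rest : suc v ≡ zero ⊎ (∃ λ t → t ∈ L × suc v ≡ suc t) → ⊥
    not-in-rest (inj₂ (_ , t∈ , refl)) = v∉ (there t∈)
    later : ∀ {r} → r ≡ zero ⊎ (∃ λ t → t ∈ L × r ≡ suc t) → r ≡ zero ⊎ (∃ λ t → t ∈ w ∷ L × r ≡ suc t)
    later (inj₁ eq) = inj₁ eq
    later (inj₂ (t , t∈ , eq)) = inj₂ (t , there t∈ , eq)

  subdivided-chain : ∀ {C} → Chain adj C → (∀ t → t ∈ C) → ∃ λ C′ → Chain G C′ × (∀ t → t ∈ C′)
  subdivided-chain {v ∷ L} ch covers = suc v ∷ rest , chain , covers′
    where
    open Inserted (insert ch (covers x) (covers y))
    old : ∀ {t} → t ∈ v ∷ L → suc t ∈ suc v ∷ rest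
    old (here refl) = here refl
    old (there t∈) = there (⊆rest t∈)
    covers′ : ∀ t → t ∈ suc v ∷ rest
    covers′ zero = there z∈rest
    covers′ (suc t) = old (covers t)

-- The case distinction on degrees.

Branch : {n : ℕ} → Adj n → Set
Branch adj = ∃ λ c → ∃ λ a₁ → ∃ λ a₂ → ∃ λ a₃ →
  (adj c a₁ ≡ true × adj c a₂ ≡ true × adj c a₃ ≡ true) × (a₁ ≢ a₂ × a₁ ≢ a₃ × a₂ ≢ a₃)

branch? : {n : ℕ} (adj : Adj n) → Dec (Branch adj)
branch? adj = any? λ c → any? λ a₁ → any? λ a₂ → any? λ a₃ →
  ((adj c a₁ ≟ᵇ true) ×-dec (adj c a₂ ≟ᵇ true) ×-dec (adj c a₃ ≟ᵇ true))
    ×-dec (¬? (a₁ ≟ a₂) ×-dec ¬? (a₁ ≟ a₃) ×-dec ¬? (a₂ ≟ a₃))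

thin-1lit : {n : ℕ} (adj : Adj n) → IsTree adj → ¬ Branch adj →
  {x y : Fin n} → adj x y ≡ true → KLit (subdivide adj x y) 1
thin-1lit adj tree no-branch x~y with Thin.thin-chain adj tree thin x~y
  where
  thin : ∀ {v a b c} → adj v a ≡ true → adj v b ≡ true → adj v c ≡ true → a ≢ b → c ≡ a ⊎ c ≡ b
  thin {v} {a} {b} {c} va vb vc a≢b with c ≟ a | c ≟ b
  ... | yes c≡a | _ = inj₁ c≡a
  ... | no _ | yes c≡b = inj₂ c≡b
  ... | no c≢a | no c≢b = ⊥-elim (no-branch (v , a , b , c , (va , vb , vc) , a≢b , (c≢a ∘ sym) , (c≢b ∘ sym)))
... | _ , ch , covers with Insertion.subdivided-chain adj (IsTree.simple tree) x~y ch covers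
...   | _ , ch′ , covers′ = ChainGame.chain-1lit _ (Insertion.G-simple adj (IsTree.simple tree) x~y) ch′ covers′

theorem1p2 : ∀ {n} (adj P : Adj n) → IsTree adj → IsPerfectMatching adj P →
    (x y : Fin n) → adj x y ≡ true →
    (OddType adj P x y → KLit (subdivide adj x y) 1) ×
    (EvenType adj P x y → KLit (subdivide adj x y) 2)
theorem1p2 adj P tree pm x y x~y with branch? adj
... | no no-branch = (λ _ → thin-1lit adj tree no-branch x~y) , λ _ f →
  let d , r , on = thin-1lit adj tree no-branch x~y f in d , r , ≤-trans on (s≤s z≤n)
... | yes (_ , _ , _ , _ , (ca₁ , ca₂ , ca₃) , a₁≢a₂ , a₁≢a₃ , a₂≢a₃)
  with Covering.ample-branch adj P tree pm ca₁ ca₂ ca₃ a₁≢a₂ a₁≢a₃ a₂≢a₃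
...   | _ , start with Covering.ample-cover adj P tree pm start
...     | _ , Covering.ample g att pℓ full _ _ , covers = odd-1lit , even-2lit
  where open Branching.Covered adj P tree pm x~y g att pℓ full covers
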